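{- For every Polish space $\mathcal{X}$ and every ordinal $1\le\xi<\omega_1$ there exists a $\boldsymbol{\Sigma}^0_{\mathrm{apb}(\xi)}$-measurable function \[ c^{\mathcal{X}}_\xi : \mathrm{BC}_\xi \to \mathcal{N} \] such that the set \[ \mathrm{B}^{\mathcal{X}}_\xi(\alpha) \,\triangle\, \mathrm{U}^{\mathcal{X}}(c^{\mathcal{X}}_\xi(\alpha)) \] is meager for all $\alpha\in\mathrm{BC}_\xi$. Moreover, one can choose the family $(c^{\mathcal{X}}_\xi)_{1\le\xi<\omega_1}$ in such a way that $c^{\mathcal{X}}_\xi\upharpoonright\mathrm{BC}_\eta = c^{\mathcal{X}}_\eta$ for all $2\le\eta<\xi$.
   Context: Notation. $\omega=\{0,1,2,\dots\}$, $\omega_1$ is the first uncountable ordinal, $\mathcal{N}=\omega^\omega$ is the Baire space with the product topology, $\triangle$ is symmetric difference. For $P\subseteq X\times Y$ and $x\in X$, the section $\{y : (x,y)\in P\}$ is denoted $P(x)$; we write $P(x,y)$ for $(x,y)\in P$. For $\alpha\in\mathcal{N}$, $\alpha^\ast=(i\mapsto\alpha(i+1))$. A Polish space is a (nonempty) separable completely metrizable topological space. $\boldsymbol{\Sigma}^0_\xi,\boldsymbol{\Pi}^0_\xi$ ($1\le\xi<\omega_1$) are the usual Borel classes. Measurability. If $\Gamma$ is a class of subsets of Polish spaces, $\mathcal{X},\mathcal{Y}$ are Polish, and $\emptyset\ne A\subseteq\mathcal{X}$, a function $f:A\to\mathcal{Y}$ is $\Gamma$-measurable if for every open $V\subseteq\mathcal{Y}$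 there is a set $W\subseteq\mathcal{X}$ in $\Gamma$ with $f^{ -1}[V]=W\cap A$. Coding of finite sequences. For $n\ge 1$, $\langle u_0,\dots,u_{n-1}\rangle = p_0^{u_0+1}\cdots p_{n-1}^{u_{n-1}+1}$, where $p_0<p_1<\dots$ are the primes; $\langle\emptyset\rangle=1$. If $s=\langle u_0,\dots,u_{n-1}\rangle$ and $i<n$, then $(s)_i:=u_i$; if $i\ge n$ or $s$ is not in the image of $\langle\cdot\rangle$, then $(s)_i:=0$. Put $q_k=(k)_0/((k)_1+1)$. Basic open sets. For every Polish space $\mathcal{X}$ (including products) a compatible metric $d_{\mathcal{X}}$ and a dense sequence $(r^{\mathcal{X}}_i)_{i\in\omega}$ are fixed (a recursive presentation when the space is recursively presented, such as $\omega\times\omega$), and $N(\mathcal{X},s)$ is the open $d_{\mathcal{X}}$-ball with center $r^{\mathcal{X}}_{(s)_0}$ and radius $q_{(s)_1}$ (empty if the radius is $0$). For $\mathcal{N}$ the choice is: $d_{\mathcal{N}}(\alpha,\beta)=(n+1)^{ -1}$ with $n$ least such that $\alpha(n)\ne\beta(n)$ if $\alpha\ne\beta$, $d_{\mathcal{N}}(\alpha,\alpha)=0$, and $r^{\mathcal{N}}_s(i)=(s)_i$. Open codes. $\mathrm{U}^{\mathcal{X}}\subseteq\mathcal{N}\times\mathcal{X}$ is defined by $\mathrm{U}^{\mathcal{X}}(\alpha,x)\iff(\exists n\in\omega)[x\in N(\mathcal{X},\alpha(n))]$. Partial functions $\{\alpha\}$. For $\alpha\in\mathcal{N}$ let $\{\alpha\}:\omega\rightharpoonup\mathcal{N}$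 be the partial function such that $\{\alpha\}(n)$ is defined (written $\{\alpha\}(n)\downarrow$) exactly when there is a unique $\beta\in\mathcal{N}$ such that for all $s\in\omega$: $\beta\in N(\mathcal{N},s)\iff\mathrm{U}^{\omega\times\omega}(\alpha,(n,s))$; in that case $\{\alpha\}(n)$ is this $\beta$. Borel codes. Define $\mathrm{BC}_\xi\subseteq\mathcal{N}$ for $\xi<\omega_1$ by recursion: $\alpha\in\mathrm{BC}_0\iff\alpha(0)=0$; and for $\xi\geq 1$, $\alpha\in\mathrm{BC}_\xi\iff\alpha(0)=1$ and for every $n$ there is $\zeta<\xi$ with $\{\alpha^\ast\}(n)\downarrow$ and $\{\alpha^\ast\}(n)\in\mathrm{BC}_\zeta$. (One has $\mathrm{BC}_\zeta\subseteq\mathrm{BC}_\xi$ for $1\le\zeta\le\xi$.) Let $\mathrm{BC}=\bigcup_{\xi<\omega_1}\mathrm{BC}_\xi$ and for $\alpha\in\mathrm{BC}$ let $|\alpha|$ be the least $\xi$ with $\alpha\in\mathrm{BC}_\xi$. For a Polish space $\mathcal{X}$ define by recursion, for $\alpha\in\mathrm{BC}_\xi$, $\pi^{\mathcal{X}}_0(\alpha)=\mathcal{X}\setminus N(\mathcal{X},\alpha(1))$, and for $\xi\ge 1$, $\pi^{\mathcal{X}}_\xi(\alpha)=\bigcup_{n}\bigl(\mathcal{X}\setminus\pi^{\mathcal{X}}_{|\{\alpha^\ast\}(n)|}(\{\alpha^\ast\}(n))\bigr)$. Put $\pi^{\mathcal{X}}(\alpha)=\pi^{\mathcal{X}}_{|\alpha|}(\alpha)$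 for $\alpha\in\mathrm{BC}$, and define $\mathrm{B}^{\mathcal{X}}_\xi\subseteq\mathcal{N}\times\mathcal{X}$ by $\mathrm{B}^{\mathcal{X}}_\xi(\alpha,x)\iff\alpha\in\mathrm{BC}_\xi$ and $x\in\pi^{\mathcal{X}}(\alpha)$. The sections of $\mathrm{B}^{\mathcal{X}}_\xi$ at points of $\mathrm{BC}_\xi$ ($\xi\geq1$) are exactly the $\boldsymbol{\Sigma}^0_\xi$ subsets of $\mathcal{X}$. The functions $\mathrm{rbc},\mathrm{apb}:\omega_1\setminus\{0\}\to\omega_1\setminus\{0\}$. $\mathrm{rbc}(\xi)$ is the least $\eta<\omega_1$ such that $\mathrm{BC}_\xi$ is a $\boldsymbol{\Pi}^0_\eta$ subset of $\mathcal{N}$. $\mathrm{apb}(1)=1$, and for $\xi>1$, $\mathrm{apb}(\xi)=\sup\{\max\{\mathrm{apb}(\eta),\mathrm{rbc}(\eta)+1\} : 1\le\eta<\xi\}+1$. -}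

module Defs where

open import Axiom.ExcludedMiddle using (ExcludedMiddle)
open import Data.Bool.Base using (if_then_else_)
open import Data.Empty using (⊥)
open import Data.Integer.Base as ℤ using (+_)
open import Data.List.Base using (List; []; _∷_)
open import Data.Nat.Base as ℕ using (ℕ; zero; suc; _!)
open import Data.Nat.Coprimality using (1-coprimeTo)
open import Data.Nat.Divisibility using (_∣?_; divides)
open import Data.Nat.Primality using (prime?)
import Data.Nat.Properties as ℕₚ
open import Data.Product.Base using (∃; _×_; _,_; proj₁; ∃-syntax; Σ-syntax)
open import Data.Product.Properties using (≡-dec)
open import Data.Rational.Base as ℚ using (ℚ; mkℚ; 0ℚ; 1ℚ; ½; *≤*; *<*)
import Data.Rational.Properties as ℚₚ
import Algebra.Properties.Group ℚₚ.+-0-group as ℚ-group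
open import Data.Sum.Base using (_⊎_; inj₁; inj₂)
open import Data.Unit.Base using (⊤; tt)
open import Function.Base using (_∘_)
open import Function.Bundles using (Func; _⇔_)
import Function.Metric.Structures as Metric
open import Induction.WellFounded using (Acc; acc; WellFounded)
open import Level as L using (Level; 0ℓ)
open import Relation.Binary.Bundles using (Setoid)
import Relation.Binary.Construct.On as On
open import Relation.Binary.PropositionalEquality as ≡ hiding (setoid)
open import Relation.Nullary using (¬_; Dec; yes; no; does)
open import Relation.Unary using (Pred; _∈_; _∉_; _⊆_; _≐_; _∪_; _∖_; ∁; ⋃; _⊢_)

private
  variable
    c ℓ c′ ℓ′ p p′ : Level

infix 4 _△_
_△_ : {A : Set c} → Pred A p → Pred A p′ → Pred A (p L.⊔ p′)
P △ Q = (P ∖ Q) ∪ (Q ∖ P)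

firstPrimeFrom : ℕ → ℕ → ℕ
firstPrimeFrom n zero    = n
firstPrimeFrom n (suc k) =
  if does (prime? n) then n else firstPrimeFrom (suc n) k

firstPrimeFrom-≥ : ∀ n k → n ℕ.≤ firstPrimeFrom n k
firstPrimeFrom-≥ n zero    = ℕₚ.≤-refl
firstPrimeFrom-≥ n (suc k) with prime? n
... | yes _ = ℕₚ.≤-refl
... | no  _ = ℕₚ.≤-trans (ℕₚ.n≤1+n n) (firstPrimeFrom-≥ (suc n) k)

-- By Euclid's argument there is a prime in the interval (n , n ! + 1], so
-- the search for the next prime never runs out of fuel.
primeAt : ℕ → ℕ
primeAt zero    = 2
primeAt (suc i) = firstPrimeFrom (suc (primeAt i)) (primeAt i !)

primeAt-≥2 : ∀ i → 2 ℕ.≤ primeAt i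
primeAt-≥2 zero    = ℕₚ.≤-refl
primeAt-≥2 (suc i) = ℕₚ.≤-trans (ℕₚ.≤-trans (primeAt-≥2 i) (ℕₚ.n≤1+n (primeAt i)))
  (firstPrimeFrom-≥ (suc (primeAt i)) (primeAt i !))

codeFrom : ℕ → List ℕ → ℕ
codeFrom i []       = 1
codeFrom i (u ∷ us) = primeAt i ℕ.^ suc u ℕ.* codeFrom (suc i) us

⟨_⟩ : List ℕ → ℕ
⟨ us ⟩ = codeFrom 0 us

n<m^1+n : ∀ m n → 2 ℕ.≤ m → n ℕ.< m ℕ.^ suc n
n<m^1+n m n 2≤m = ℕₚ.<-≤-trans (ℕₚ.<-trans (n<2^n n) (ℕₚ.^-monoʳ-< 2 (ℕₚ.≤-refl {2}) (ℕₚ.n<1+n n)))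
                    (ℕₚ.^-monoˡ-≤ (suc n) 2≤m)
  where
  n<2^n : ∀ k → k ℕ.< 2 ℕ.^ k
  n<2^n zero    = ℕₚ.≤-refl
  n<2^n (suc k) = ℕₚ.≤-trans (ℕₚ.+-mono-≤ (ℕₚ.≤-trans (ℕ.s≤s ℕ.z≤n) (n<2^n k)) (n<2^n k))
    (ℕₚ.≤-reflexive (cong (2 ℕ.^ k ℕ.+_) (sym (ℕₚ.+-identityʳ (2 ℕ.^ k)))))

codeFrom-≥1 : ∀ i us → 1 ℕ.≤ codeFrom i us
codeFrom-≥1 i []       = ℕₚ.≤-refl
codeFrom-≥1 i (u ∷ us) = ℕₚ.*-mono-≤
  (ℕₚ.≤-trans (ℕ.s≤s ℕ.z≤n) (n<m^1+n (primeAt i) u (primeAt-≥2 i)))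
  (codeFrom-≥1 (suc i) us)

decode : ∀ fuel i s → s ℕ.≤ fuel → Dec (∃[ us ] codeFrom i us ≡ s)
decode zero       i .0 ℕ.z≤n = no λ (us , eq) →
  ℕₚ.<-irrefl refl (subst (1 ℕ.≤_) eq (codeFrom-≥1 i us))
decode (suc fuel) i s  s≤ with s ℕₚ.≟ 1
... | yes s≡1 = yes ([] , sym s≡1)
... | no  s≢1 with s ℕₚ.≟ 0
...   | yes refl = no λ (us , eq) →
          ℕₚ.<-irrefl refl (subst (1 ℕ.≤_) eq (codeFrom-≥1 i us))
...   | no  s≢0 = finish (ℕₚ.anyUpTo? step s)
  where
  P : ℕ → Set
  P u = ∃[ us ] codeFrom i (u ∷ us) ≡ s

  step : ∀ u → Dec (P u)
  step u with (primeAt i ℕ.^ suc u) ∣? s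
  ... | no  ∤s = no λ (us , eq) →
          ∤s (divides (codeFrom (suc i) us)
            (trans (sym eq) (ℕₚ.*-comm (primeAt i ℕ.^ suc u) (codeFrom (suc i) us))))
  ... | yes (divides t s≡) = finish′ (decode fuel (suc i) t t≤)
    where
    m : ℕ
    m = primeAt i ℕ.^ suc u

    2≤m : 2 ℕ.≤ m
    2≤m = ℕₚ.≤-trans (ℕₚ.≤-trans (primeAt-≥2 i) (ℕₚ.≤-reflexive (sym (ℕₚ.*-identityʳ (primeAt i)))))
            (ℕₚ.^-monoʳ-≤ (primeAt i) {{ℕ.>-nonZero (ℕₚ.≤-trans (ℕ.s≤s ℕ.z≤n) (primeAt-≥2 i))}}
              {1} {suc u} (ℕ.s≤s ℕ.z≤n))

    t≢0 : ¬ (t ≡ 0)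
    t≢0 refl = s≢0 s≡

    t<s : t ℕ.< s
    t<s = ℕₚ.<-≤-trans
      (ℕₚ.m<m*n t m {{ℕ.≢-nonZero t≢0}} 2≤m)
      (ℕₚ.≤-reflexive (sym s≡))

    t≤ : t ℕ.≤ fuel
    t≤ = ℕₚ.≤-pred (ℕₚ.≤-trans t<s s≤)

    finish′ : Dec (∃[ us ] codeFrom (suc i) us ≡ t) → Dec (P u)
    finish′ (yes (us , eq)) = yes (us ,
      trans (cong (m ℕ.*_) eq) (trans (ℕₚ.*-comm m t) (sym s≡)))
    finish′ (no ∄) = no λ (us , eq) → ∄ (us ,
      ℕₚ.*-cancelˡ-≡ _ _ m {{ℕ.>-nonZero (ℕₚ.≤-trans (ℕ.s≤s ℕ.z≤n) 2≤m)}}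
        (trans eq (trans s≡ (ℕₚ.*-comm t m))))

  finish : Dec (∃[ u ] u ℕ.< s × P u) → Dec (∃[ us ] codeFrom i us ≡ s)
  finish (yes (u , _ , us , eq)) = yes (u ∷ us , eq)
  finish (no ∄) = no λ where
    ([]     , eq) → s≢1 (sym eq)
    (u ∷ us , eq) → ∄ (u ,
      ℕₚ.<-≤-trans (n<m^1+n (primeAt i) u (primeAt-≥2 i))
        (ℕₚ.≤-trans (ℕₚ.m≤m*n (primeAt i ℕ.^ suc u) (codeFrom (suc i) us)
          {{ℕ.>-nonZero (codeFrom-≥1 (suc i) us)}}) (ℕₚ.≤-reflexive eq)) ,
      us , eq)

isCode? : ∀ s → Dec (∃[ us ] ⟨ us ⟩ ≡ s)
isCode? s = decode s 0 s ℕₚ.≤-refl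

entry : List ℕ → ℕ → ℕ
entry []       _       = 0
entry (u ∷ us) zero    = u
entry (u ∷ us) (suc i) = entry us i

infixl 9 ⦅_⦆_
⦅_⦆_ : ℕ → ℕ → ℕ
⦅ s ⦆ i with isCode? s
... | yes (us , _) = entry us i
... | no  _        = 0

radius : ℕ → ℚ
radius k = + (⦅ k ⦆ 0) ℚ./ suc (⦅ k ⦆ 1)

-- A real number is a Cauchy sequence of rationals, up to _≈ᵣ_.
record ℝ : Set where
  field
    seq    : ℕ → ℚ
    cauchy : ∀ ε → 0ℚ ℚ.< ε →
             ∃[ k ] (∀ m n → k ℕ.≤ m → k ℕ.≤ n → ℚ.∣ seq m ℚ.- seq n ∣ ℚ.< ε)
open ℝ public

infix 4 _≤ᵣ_ _<ᵣ_ _≈ᵣ_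

_≤ᵣ_ : ℝ → ℝ → Set
x ≤ᵣ y = ∀ ε → 0ℚ ℚ.< ε → ∃[ k ] (∀ n → k ℕ.≤ n → seq x n ℚ.< seq y n ℚ.+ ε)

_<ᵣ_ : ℝ → ℝ → Set
x <ᵣ y = ∃[ ε ] 0ℚ ℚ.< ε × ∃[ k ] (∀ n → k ℕ.≤ n → seq x n ℚ.+ ε ℚ.< seq y n)

_≈ᵣ_ : ℝ → ℝ → Set
x ≈ᵣ y = x ≤ᵣ y × y ≤ᵣ x

∣p-p∣<ε : ∀ p {ε} → 0ℚ ℚ.< ε → ℚ.∣ p ℚ.- p ∣ ℚ.< ε
∣p-p∣<ε p 0<ε = subst (ℚ._< _) (sym (cong ℚ.∣_∣ (ℚₚ.+-inverseʳ p))) 0<ε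

fromℚ : ℚ → ℝ
fromℚ q = record { seq = λ _ → q ; cauchy = λ ε 0<ε → 0 , λ m n _ _ → ∣p-p∣<ε q 0<ε }

0ᵣ : ℝ
0ᵣ = fromℚ 0ℚ

half-pos : ∀ {ε} → 0ℚ ℚ.< ε → 0ℚ ℚ.< ½ ℚ.* ε
half-pos {ε} 0<ε = subst (ℚ._< ½ ℚ.* ε) (ℚₚ.*-zeroʳ ½) (ℚₚ.*-monoʳ-<-pos ½ 0<ε)

half+half : ∀ ε → ½ ℚ.* ε ℚ.+ ½ ℚ.* ε ≡ ε
half+half ε = trans (sym (ℚₚ.*-distribʳ-+ ε ½ ½)) (ℚₚ.*-identityˡ ε)

interchange : ∀ a b c d → (a ℚ.+ b) ℚ.- (c ℚ.+ d) ≡ (a ℚ.- c) ℚ.+ (b ℚ.- d)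
interchange a b c d = begin
  (a ℚ.+ b) ℚ.+ ℚ.- (c ℚ.+ d)         ≡⟨ cong (a ℚ.+ b ℚ.+_) (ℚₚ.neg-distrib-+ c d) ⟩
  (a ℚ.+ b) ℚ.+ (ℚ.- c ℚ.+ ℚ.- d)     ≡⟨ ℚₚ.+-assoc a b (ℚ.- c ℚ.+ ℚ.- d) ⟩
  a ℚ.+ (b ℚ.+ (ℚ.- c ℚ.+ ℚ.- d))     ≡⟨ cong (a ℚ.+_) (sym (ℚₚ.+-assoc b (ℚ.- c) (ℚ.- d))) ⟩
  a ℚ.+ ((b ℚ.+ ℚ.- c) ℚ.+ ℚ.- d)     ≡⟨ cong (λ z → a ℚ.+ (z ℚ.+ ℚ.- d)) (ℚₚ.+-comm b (ℚ.- c)) ⟩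
  a ℚ.+ ((ℚ.- c ℚ.+ b) ℚ.+ ℚ.- d)     ≡⟨ cong (a ℚ.+_) (ℚₚ.+-assoc (ℚ.- c) b (ℚ.- d)) ⟩
  a ℚ.+ (ℚ.- c ℚ.+ (b ℚ.+ ℚ.- d))     ≡⟨ sym (ℚₚ.+-assoc a (ℚ.- c) (b ℚ.+ ℚ.- d)) ⟩
  (a ℚ.+ ℚ.- c) ℚ.+ (b ℚ.+ ℚ.- d) ∎
  where
  open ≡-Reasoning

infixl 6 _+ᵣ_
_+ᵣ_ : ℝ → ℝ → ℝ
x +ᵣ y = record
  { seq    = λ n → seq x n ℚ.+ seq y n
  ; cauchy = λ ε 0<ε →
      let k , close  = cauchy x (½ ℚ.* ε) (half-pos 0<ε)
          k′ , close′ = cauchy y (½ ℚ.* ε) (half-pos 0<ε)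
      in k ℕ.⊔ k′ , λ m n ≤m ≤n → begin-strict
        ℚ.∣ (seq x m ℚ.+ seq y m) ℚ.- (seq x n ℚ.+ seq y n) ∣
          ≡⟨ cong ℚ.∣_∣ (interchange (seq x m) (seq y m) (seq x n) (seq y n)) ⟩
        ℚ.∣ (seq x m ℚ.- seq x n) ℚ.+ (seq y m ℚ.- seq y n) ∣
          ≤⟨ ℚₚ.∣p+q∣≤∣p∣+∣q∣ (seq x m ℚ.- seq x n) (seq y m ℚ.- seq y n) ⟩
        ℚ.∣ seq x m ℚ.- seq x n ∣ ℚ.+ ℚ.∣ seq y m ℚ.- seq y n ∣
          <⟨ ℚₚ.+-mono-<
               (close m n (ℕₚ.≤-trans (ℕₚ.m≤m⊔n k k′) ≤m) (ℕₚ.≤-trans (ℕₚ.m≤m⊔n k k′) ≤n))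
               (close′ m n (ℕₚ.≤-trans (ℕₚ.m≤n⊔m k k′) ≤m) (ℕₚ.≤-trans (ℕₚ.m≤n⊔m k k′) ≤n)) ⟩
        ½ ℚ.* ε ℚ.+ ½ ℚ.* ε
          ≡⟨ half+half ε ⟩
        ε ∎
  }
  where open ℚₚ.≤-Reasoning

-- The raw data: carrier, metric, and dense sequence.  The topology is the
-- one induced by d.
record Presentation (c ℓ : Level) : Set (L.suc (c L.⊔ ℓ)) where
  field
    setoid : Setoid c ℓ
  open Setoid setoid public using (Carrier; _≈_)
  field
    d : Carrier → Carrier → ℝ
    r : ℕ → Carrier

open Presentation using (Carrier)

IsMetric : (S : Setoid c ℓ) → (Setoid.Carrier S → Setoid.Carrier S → ℝ) → Set (c L.⊔ ℓ)
IsMetric S = Metric.IsGeneralMetric (Setoid._≈_ S) _≈ᵣ_ _≤ᵣ_ 0ᵣ _+ᵣ_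

module _ {X : Set c} where

  Ball : (X → X → ℝ) → X → ℚ → Pred X 0ℓ
  Ball d x ε y = d x y <ᵣ fromℚ ε

  Complete : (X → X → ℝ) → Set c
  Complete d = ∀ (x : ℕ → X) →
    (∀ ε → 0ℚ ℚ.< ε → ∃[ k ] (∀ m n → k ℕ.≤ m → k ℕ.≤ n → x n ∈ Ball d (x m) ε)) →
    ∃[ l ] (∀ ε → 0ℚ ℚ.< ε → ∃[ k ] (∀ n → k ℕ.≤ n → x n ∈ Ball d l ε))

  Finer : (X → X → ℝ) → (X → X → ℝ) → Set c
  Finer d d′ = ∀ x ε → 0ℚ ℚ.< ε → ∃[ δ ] 0ℚ ℚ.< δ × Ball d x δ ⊆ Ball d′ x ε

-- The fixed metric d has to be compatible with the topology, but only some
-- compatible metric is required to be complete.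
record IsPolish (X : Presentation c ℓ) : Set (c L.⊔ ℓ) where
  open Presentation X
  field
    isMetric : IsMetric setoid d
    dense    : ∀ x ε → 0ℚ ℚ.< ε → ∃[ i ] r i ∈ Ball d x ε
    completelyMetrizable :
      ∃[ d′ ] IsMetric setoid d′ × Finer d d′ × Finer d′ d × Complete d′

record PolishSpace (c ℓ : Level) : Set (L.suc (c L.⊔ ℓ)) where
  field
    presentation : Presentation c ℓ
    isPolish     : IsPolish presentation

module _ (X : Presentation c ℓ) where
  open Presentation X hiding (Carrier)

  Interior : Pred (Carrier X) p → Pred (Carrier X) (c L.⊔ p)
  Interior A x = ∃[ ε ] 0ℚ ℚ.< ε × Ball d x ε ⊆ A

  Closure : Pred (Carrier X) p → Pred (Carrier X) (c L.⊔ p)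
  Closure A x = ∀ ε → 0ℚ ℚ.< ε → ∃[ y ] y ∈ Ball d x ε × y ∈ A

  IsOpen : Pred (Carrier X) p → Set (c L.⊔ p)
  IsOpen A = A ⊆ Interior A

  NowhereDense : Pred (Carrier X) p → Set (c L.⊔ p)
  NowhereDense A = ∀ x → x ∉ Interior (Closure A)

  Meager : Pred (Carrier X) p → Set (c L.⊔ L.suc p)
  Meager {p = p} A =
    Σ[ F ∈ (ℕ → Pred (Carrier X) p) ] (∀ n → NowhereDense (F n)) × A ⊆ ⋃ ℕ F

  N : ℕ → Pred (Carrier X) 0ℓ
  N s x = d x (r (⦅ s ⦆ 0)) <ᵣ fromℚ (radius (⦅ s ⦆ 1))

  U : (ℕ → ℕ) → Pred (Carrier X) 0ℓ
  U α x = ∃[ n ] x ∈ N (α n)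

-- The recursive presentation by the discrete metric, with the i-th point
-- of the dense sequence read off from the code i.
ω×ω : Presentation 0ℓ 0ℓ
ω×ω = record
  { setoid = ≡.setoid (ℕ × ℕ)
  ; d      = λ x y → fromℚ (if does (≡-dec ℕₚ._≟_ ℕₚ._≟_ x y) then 0ℚ else 1ℚ)
  ; r      = λ i → ⦅ i ⦆ 0 , ⦅ i ⦆ 1
  }

-- The least n < k at which α and β differ, or k if there is none.
firstDiff : (ℕ → ℕ) → (ℕ → ℕ) → ℕ → ℕ
firstDiff α β zero    = zero
firstDiff α β (suc k) with α 0 ℕₚ.≟ β 0
... | yes _ = suc (firstDiff (α ∘ suc) (β ∘ suc) k)
... | no  _ = zero

firstDiff-stable : ∀ α β k m n → k ℕ.≤ m → k ℕ.≤ n →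
  firstDiff α β m ≡ firstDiff α β n ⊎
  (k ℕ.≤ firstDiff α β m × k ℕ.≤ firstDiff α β n)
firstDiff-stable α β zero    m       n       _         _         = inj₂ (ℕ.z≤n , ℕ.z≤n)
firstDiff-stable α β (suc k) (suc m) (suc n) (ℕ.s≤s p) (ℕ.s≤s q) with α 0 ℕₚ.≟ β 0
... | no  _ = inj₁ refl
... | yes _ with firstDiff-stable (α ∘ suc) (β ∘ suc) k m n p q
...   | inj₁ eq      = inj₁ (cong suc eq)
...   | inj₂ (a , b) = inj₂ (ℕ.s≤s a , ℕ.s≤s b)

1/1+_ : ℕ → ℚ
1/1+ n = + 1 ℚ./ suc n

1/1+-canonical : ∀ n → 1/1+ n ≡ mkℚ (+ 1) n (1-coprimeTo (suc n))
1/1+-canonical n = ℚₚ.normalize-coprime (1-coprimeTo (suc n))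

1/1+-anti : ∀ {m n} → m ℕ.≤ n → 1/1+ n ℚ.≤ 1/1+ m
1/1+-anti {m} {n} m≤n rewrite 1/1+-canonical m | 1/1+-canonical n =
  *≤* (ℤ.+≤+ (ℕₚ.+-mono-≤ (ℕ.s≤s m≤n) (ℕ.z≤n {0})))

1/1+-pos : ∀ n → 0ℚ ℚ.< 1/1+ n
1/1+-pos n rewrite 1/1+-canonical n = *<* (ℤ.+<+ (ℕ.s≤s ℕ.z≤n))

archimedean : ∀ ε → 0ℚ ℚ.< ε → ∃[ k ] 1/1+ k ℚ.< ε
archimedean (mkℚ (+ zero)    d-1 _) (*<* (ℤ.+<+ ()))
archimedean (mkℚ (+ suc n)   d-1 _) _ = suc d-1 , lemma
  where
  lemma : 1/1+ (suc d-1) ℚ.< mkℚ (+ suc n) d-1 _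
  lemma rewrite 1/1+-canonical (suc d-1) = *<* (ℤ.+<+ (ℕₚ.<-≤-trans
    (subst (ℕ._< suc (suc d-1)) (sym (ℕₚ.+-identityʳ (suc d-1))) ℕₚ.≤-refl)
    (ℕₚ.m≤m+n (suc (suc d-1)) (n ℕ.* suc (suc d-1)))))
archimedean (mkℚ (ℤ.-[1+ n ]) d-1 _) (*<* ())

∣p-q∣≤δ : ∀ {a b δ} → 0ℚ ℚ.≤ a → a ℚ.≤ δ → 0ℚ ℚ.≤ b → b ℚ.≤ δ → ℚ.∣ a ℚ.- b ∣ ℚ.≤ δ
∣p-q∣≤δ {a} {b} {δ} 0≤a a≤δ 0≤b b≤δ with ℚₚ.∣p∣≡p∨∣p∣≡-p (a ℚ.- b)
... | inj₁ eq = begin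
  ℚ.∣ a ℚ.- b ∣ ≡⟨ eq ⟩
  a ℚ.- b       ≤⟨ ℚₚ.+-mono-≤ a≤δ (ℚₚ.neg-antimono-≤ 0≤b) ⟩
  δ ℚ.+ 0ℚ      ≡⟨ ℚₚ.+-identityʳ δ ⟩
  δ             ∎
  where open ℚₚ.≤-Reasoning
... | inj₂ eq = begin
  ℚ.∣ a ℚ.- b ∣             ≡⟨ eq ⟩
  ℚ.- (a ℚ.- b)             ≡⟨ ℚₚ.neg-distrib-+ a (ℚ.- b) ⟩
  ℚ.- a ℚ.+ ℚ.- (ℚ.- b)     ≡⟨ cong (ℚ.- a ℚ.+_) (ℚ-group.⁻¹-involutive b) ⟩
  ℚ.- a ℚ.+ b               ≤⟨ ℚₚ.+-mono-≤ (ℚₚ.neg-antimono-≤ 0≤a) b≤δ ⟩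
  0ℚ ℚ.+ δ                  ≡⟨ ℚₚ.+-identityˡ δ ⟩
  δ                         ∎
  where open ℚₚ.≤-Reasoning

-- 1/(n+1) for the least n with α n ≢ β n, and 0 if there is none, presented
-- as the limit of what is known after comparing the first k values.
distᴺ : (ℕ → ℕ) → (ℕ → ℕ) → ℝ
distᴺ α β = record
  { seq    = λ k → + 1 ℚ./ suc (firstDiff α β k)
  ; cauchy = λ ε 0<ε →
      let k , 1/1+k<ε = archimedean ε 0<ε
      in k , λ m n ≤m ≤n → close k m n ε 0<ε 1/1+k<ε (firstDiff-stable α β k m n ≤m ≤n)
  }
  where
  close : ∀ k m n ε → 0ℚ ℚ.< ε → 1/1+ k ℚ.< ε →
    firstDiff α β m ≡ firstDiff α β n ⊎ (k ℕ.≤ firstDiff α β m × k ℕ.≤ firstDiff α β n) →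
    ℚ.∣ 1/1+ firstDiff α β m ℚ.- 1/1+ firstDiff α β n ∣ ℚ.< ε
  close k m n ε 0<ε _ (inj₁ eq) rewrite eq = ∣p-p∣<ε (1/1+ firstDiff α β n) 0<ε
  close k m n ε 0<ε 1/1+k<ε (inj₂ (a , b)) = ℚₚ.≤-<-trans
    (∣p-q∣≤δ (ℚₚ.<⇒≤ (1/1+-pos (firstDiff α β m))) (1/1+-anti a)
             (ℚₚ.<⇒≤ (1/1+-pos (firstDiff α β n))) (1/1+-anti b))
    1/1+k<ε

𝒩 : Presentation 0ℓ 0ℓ
𝒩 = record
  { setoid = ℕ →-setoid ℕ
  ; d      = distᴺ
  ; r      = λ s i → ⦅ s ⦆ i
  }

-- Every countable ordinal is zero or the least strict upper bound of a
-- sequence of countable ordinals.  Different trees may denote the same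
-- ordinal; equality of ordinals is _≈ₒ_, and ω₁ is Ord modulo _≈ₒ_.
data Ord : Set where
  zeroₒ : Ord
  lsub  : (ℕ → Ord) → Ord

infix 4 _≤ₒ_ _<ₒ_ _≈ₒ_

_≤ₒ_ : Ord → Ord → Set
zeroₒ  ≤ₒ _      = ⊤
lsub f ≤ₒ zeroₒ  = ⊥
lsub f ≤ₒ lsub g = ∀ m → ∃[ n ] f m ≤ₒ g n

_<ₒ_ : Ord → Ord → Set
ζ <ₒ zeroₒ  = ⊥
ζ <ₒ lsub g = ∃[ n ] ζ ≤ₒ g n

_≈ₒ_ : Ord → Ord → Set
ζ ≈ₒ ξ = ζ ≤ₒ ξ × ξ ≤ₒ ζ

sucₒ : Ord → Ord
sucₒ ξ = lsub λ _ → ξ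

oneₒ twoₒ : Ord
oneₒ = sucₒ zeroₒ
twoₒ = sucₒ oneₒ

≤ₒ-refl : ∀ ζ → ζ ≤ₒ ζ
≤ₒ-refl zeroₒ    = tt
≤ₒ-refl (lsub f) = λ m → m , ≤ₒ-refl (f m)

≤ₒ-trans : ∀ {ζ η ξ} → ζ ≤ₒ η → η ≤ₒ ξ → ζ ≤ₒ ξ
≤ₒ-trans {zeroₒ}  {_}      {_}      _ _ = tt
≤ₒ-trans {lsub f} {lsub g} {lsub h} p q = λ m →
  let n , fm≤gn = p m
      k , gn≤hk = q n
  in k , ≤ₒ-trans {f m} {g n} {h k} fm≤gn gn≤hk

<ₒ-wellFounded : WellFounded _<ₒ_
<ₒ-wellFounded ξ = below ξ ξ (≤ₒ-refl ξ)
  where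
  below : ∀ ξ ζ → ζ ≤ₒ ξ → Acc _<ₒ_ ζ
  below ξ        zeroₒ    _ = acc λ ()
  below (lsub g) (lsub f) p = acc λ {ζ} (m , ζ≤fm) →
    let n , fm≤gn = p m in below (g n) ζ (≤ₒ-trans {ζ} {f m} {g n} ζ≤fm fm≤gn)

IsLeast : Pred Ord p → Pred Ord p
IsLeast P ξ = P ξ × (∀ η → P η → ξ ≤ₒ η)

module _ (X : Presentation c ℓ) where

  mutual
    data Σ⁰ (ξ : Ord) (A : Pred (Carrier X) 0ℓ) : Set (L.suc 0ℓ L.⊔ c) where
      isOpen : ξ ≈ₒ oneₒ → IsOpen X A → Σ⁰ ξ A
      union  : twoₒ ≤ₒ ξ → (P : ℕ → Pred (Carrier X) 0ℓ) →
               (∀ n → ∃[ ζ ] oneₒ ≤ₒ ζ × ζ <ₒ ξ × Π⁰ ζ (P n)) →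
               A ≐ ⋃ ℕ P → Σ⁰ ξ A

    data Π⁰ (ξ : Ord) (A : Pred (Carrier X) 0ℓ) : Set (L.suc 0ℓ L.⊔ c) where
      complement : (B : Pred (Carrier X) 0ℓ) → Σ⁰ ξ B → A ≐ ∁ B → Π⁰ ξ A

Subspace : (X : Presentation c ℓ) → Pred (Carrier X) p → Setoid (c L.⊔ p) ℓ
Subspace X A = On.setoid (Presentation.setoid X) (proj₁ {B = A})

Measurable : (X : Presentation c ℓ) (Y : Presentation c′ ℓ′) {A : Pred (Carrier X) 0ℓ} →
             Pred (Pred (Carrier X) 0ℓ) p →
             Func (Subspace X A) (Presentation.setoid Y) →
             Set (L.suc 0ℓ L.⊔ c L.⊔ c′ L.⊔ p)
Measurable X Y Γ f = ∀ (V : Pred (Carrier Y) 0ℓ) → IsOpen Y V →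
  ∃[ W ] W ∈ Γ × (Func.to f ⊢ V) ≐ (proj₁ ⊢ W)

infix 8 _*
_* : (ℕ → ℕ) → ℕ → ℕ
(α *) i = α (suc i)

module _ (α : ℕ → ℕ) (n : ℕ) where

  IsValue : Pred (ℕ → ℕ) 0ℓ
  IsValue β = ∀ s → β ∈ N 𝒩 s ⇔ (n , s) ∈ U ω×ω α

-- ⟪ α ⟫ n ↓ β means that {α}(n) is defined and equal to β.
⟪_⟫_↓_ : (ℕ → ℕ) → ℕ → Pred (ℕ → ℕ) 0ℓ
⟪ α ⟫ n ↓ β = IsValue α n β × (∀ β′ → IsValue α n β′ → β′ ≗ β)

data BC (ξ : Ord) (α : ℕ → ℕ) : Set where
  base : ξ ≈ₒ zeroₒ → α 0 ≡ 0 → BC ξ α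
  step : oneₒ ≤ₒ ξ → α 0 ≡ 1 →
         (∀ n → ∃[ ζ ] ζ <ₒ ξ × ∃[ β ] ⟪ α * ⟫ n ↓ β × BC ζ β) → BC ξ α

∣_∣≡_ : (ℕ → ℕ) → Ord → Set
∣ α ∣≡ ξ = IsLeast (λ ζ → BC ζ α) ξ

module _ (X : Presentation c ℓ) where

  -- For α ∈ BC ξ the rank of each {α*}(n) is automatically below ξ; the
  -- condition ζ <ₒ ξ only serves to justify the recursion.
  πAcc : ∀ ξ → Acc _<ₒ_ ξ → (ℕ → ℕ) → Pred (Carrier X) 0ℓ
  πAcc ξ (acc rs) α x =
    (ξ ≈ₒ zeroₒ × x ∉ N X (α 1)) ⊎
    (oneₒ ≤ₒ ξ × ∃[ n ] ∃[ β ] ⟪ α * ⟫ n ↓ β ×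
      ∃[ ζ ] ∣ β ∣≡ ζ × Σ[ ζ<ξ ∈ ζ <ₒ ξ ] ¬ πAcc ζ (rs ζ<ξ) β x)

  π[_] : Ord → (ℕ → ℕ) → Pred (Carrier X) 0ℓ
  π[ ξ ] = πAcc ξ (<ₒ-wellFounded ξ)

  π : (ℕ → ℕ) → Pred (Carrier X) 0ℓ
  π α x = ∃[ ζ ] ∣ α ∣≡ ζ × x ∈ π[ ζ ] α

  B : Ord → (ℕ → ℕ) → Pred (Carrier X) 0ℓ
  B ξ α x = BC ξ α × x ∈ π α

-- "The least ξ such that …" is a definite description, which needs
-- classical logic to be turned into a function.
module _ (em : ∀ {a} → ExcludedMiddle a) where

  least : Pred Ord p → Ord
  least P with em {P = ∃ (IsLeast P)}
  ... | yes (ξ , _) = ξ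
  ... | no  _       = zeroₒ

  sup : Pred Ord p → Ord
  sup P = least λ ξ → ∀ ζ → P ζ → ζ ≤ₒ ξ

  max : Ord → Ord → Ord
  max ζ η = sup λ ξ → ξ ≡ ζ ⊎ ξ ≡ η

  rbc : Ord → Ord
  rbc ξ = least λ η → oneₒ ≤ₒ η × Π⁰ 𝒩 η (BC ξ)

  apbAcc : ∀ ξ → Acc _<ₒ_ ξ → Ord
  apbAcc ξ (acc rs) with em {P = ξ ≈ₒ oneₒ}
  ... | yes _ = oneₒ
  ... | no  _ = sucₒ (sup λ ζ → ∃[ η ] Σ[ η<ξ ∈ η <ₒ ξ ] oneₒ ≤ₒ η ×
                  ζ ≡ max (apbAcc η (rs η<ξ)) (sucₒ (rbc η)))

  apb : Ord → Ord
  apb ξ = apbAcc ξ (<ₒ-wellFounded ξ)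

{-# OPTIONS --safe #-}

-- A Borel code α of rank at least 1 denotes ⋃ₙ ∁ π(αₙ), where αₙ = {α*}(n).  If αₙ has
-- rank 0, then ∁ π(αₙ) is a basic open set.  Otherwise, π(αₙ) agrees by induction with an
-- open set O up to a meager set, and so ∁ π(αₙ) agrees with the exterior of O up to a
-- meager set, as the boundary of O is nowhere dense.  The exterior is the union of the
-- basic open sets disjoint from O, which gives a code c(α) by recursion on the derivation
-- of α ∈ BC ξ.  It depends neither on ξ nor on the derivation, so that one function c
-- serves all ξ, and it reads off X only which pairs of basic open sets are disjoint.
--
-- For measurability, "c(α)(⟨n, s⟩) = j" is a countable union over η < ξ of conditions on
-- αₙ, namely αₙ ∈ BC η together with a Boolean combination of the condition that s be
-- disjoint from U(c(αₙ)).  The former is Π⁰ of rank rbc(η) and the latter is Π⁰ of rank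
-- apb(η), both below apb(ξ).  As α ↦ αₙ is continuous on its domain, these conditions
-- pull back to α without an increase in rank.  That rbc and apb do not take junk values
-- rests on BC ξ being Borel and on there being only countably many ordinals below ξ.
module Submission where

open import Defs

open import Axiom.ExcludedMiddle using (ExcludedMiddle)
open import Data.Bool.Base using (Bool; true; false; if_then_else_)
open import Data.Empty using (⊥; ⊥-elim)
open import Data.Integer.Base as ℤ using (+_)
open import Data.List.Base using (List; []; _∷_)
open import Data.List.Relation.Unary.All using (_∷_)
open import Data.Nat.Base as ℕ using (ℕ; zero; suc; _!)
open import Data.Nat.Divisibility
  using (_∣_; ∣-trans; ∣1⇒≡1; ∣m+n∣m⇒∣n; m≤n⇒m!∣n!; m∣m*n; ∣⇒≤)
open import Data.Nat.Primality
  using (Prime; prime?; prime[2]; prime⇒irreducible; prime⇒nonTrivial; prime⇒nonZero;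
         euclidsLemma)
open import Data.Nat.Primality.Factorisation using (factorise)
import Data.Nat.Properties as ℕₚ
open import Data.Product.Base using (∃; _×_; _,_; proj₁; proj₂; ∃-syntax; Σ-syntax)
open import Data.Rational.Base as ℚ using (ℚ; 0ℚ; ½; *<*)
import Data.Rational.Properties as ℚₚ
import Algebra.Properties.Group ℚₚ.+-0-group as ℚ-group
open import Data.Sum.Base using (_⊎_; inj₁; inj₂; [_,_]′)
open import Data.Unit.Base using (tt)
open import Function.Base using (_∘_)
open import Function.Bundles using (Func; mk⇔; Equivalence)
import Function.Metric.Structures as Metric
open import Induction.WellFounded using (Acc; acc)
open import Level using (Level; 0ℓ)
open import Relation.Binary.Bundles using (Setoid)
open import Relation.Binary.PropositionalEquality hiding (setoid)
open import Relation.Nullary using (¬_; Dec; yes; no; does)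
open import Relation.Nullary.Decidable using (decidable-stable; dec-true)
open import Relation.Unary using (Pred; _∈_; _∉_; _⊆_; _≐_; _∪_; _∩_; ∁; ⋃)

private
  variable
    p q : Level
    ζ ξ : Ord
    A A′ V : Pred (ℕ → ℕ) 0ℓ
    P : ℕ → Pred (ℕ → ℕ) 0ℓ

-- Primes and the injectivity of the coding of finite sequences

prime≢1 : ∀ {p} → Prime p → p ≢ 1
prime≢1 pr refl with () ← ℕ.NonTrivial.nonTrivial (prime⇒nonTrivial pr)

∃-prime-divisor : ∀ m → 2 ℕ.≤ m → ∃[ p ] Prime p × p ∣ m
∃-prime-divisor m@(suc _) 2≤m with factorise m
... | record { factors = [] ; isFactorisation = eq } =
  ⊥-elim (ℕₚ.<-irrefl (sym eq) 2≤m)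
... | record { factors = p ∷ ps ; isFactorisation = eq ; factorsPrime = pr ∷ _ } =
  p , pr , subst (p ∣_) (sym eq) (m∣m*n _)

n∣n! : ∀ n → .{{ℕ.NonZero n}} → n ∣ n !
n∣n! (suc n) = m∣m*n (n !)

-- Euclid's argument: a prime divisor of `n ! + 1` that were at most `n` would divide `n !` and
-- hence 1.
prime-between : ∀ n → ∃[ p ] Prime p × n ℕ.< p × p ℕ.≤ suc (n !)
prime-between n with ∃-prime-divisor (suc (n !)) (ℕ.s≤s (ℕₚ.1≤n! n))
... | p , pr , p∣ = p , pr , ℕₚ.≰⇒> p≰n , ∣⇒≤ p∣
  where
  p≰n : ¬ (p ℕ.≤ n)
  p≰n p≤n = prime≢1 pr (∣1⇒≡1 (∣m+n∣m⇒∣n (subst (p ∣_) (ℕₚ.+-comm 1 (n !)) p∣)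
    (∣-trans (n∣n! p {{prime⇒nonZero pr}}) (m≤n⇒m!∣n! p≤n))))

-- When its fuel runs out, `firstPrimeFrom` returns the current number untested. A prime within
-- reach of the search makes it stop before that.
firstPrimeFrom-prime : ∀ n k p → Prime p → n ℕ.≤ p → p ℕ.< n ℕ.+ k → Prime (firstPrimeFrom n k)
firstPrimeFrom-prime n zero    p pr n≤p p< =
  ⊥-elim (ℕₚ.<⇒≱ p< (subst (ℕ._≤ p) (sym (ℕₚ.+-identityʳ n)) n≤p))
firstPrimeFrom-prime n (suc k) p pr n≤p p< with prime? n
... | yes prn = prn
... | no ¬prn = firstPrimeFrom-prime (suc n) k p pr
  (ℕₚ.≤∧≢⇒< n≤p λ { refl → ¬prn pr }) (subst (p ℕ.<_) (ℕₚ.+-suc n k) p<)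

primeAt-prime : ∀ i → Prime (primeAt i)
primeAt-prime zero    = prime[2]
primeAt-prime (suc i) with prime-between (primeAt i)
... | p , pr , n<p , p≤ = firstPrimeFrom-prime (suc (primeAt i)) (primeAt i !) p pr n<p
  (ℕₚ.≤-<-trans p≤ (ℕ.s≤s (ℕₚ.+-monoˡ-≤ (primeAt i !)
    (ℕₚ.≤-trans (ℕₚ.n≤1+n 1) (primeAt-≥2 i)))))

primeAt-< : ∀ {i j} → i ℕ.< j → primeAt i ℕ.< primeAt j
primeAt-< {i} {suc j} (ℕ.s≤s i≤j) with ℕₚ.m≤n⇒m<n∨m≡n i≤j
... | inj₂ refl = firstPrimeFrom-≥ (suc (primeAt i)) (primeAt i !)
... | inj₁ i<j  = ℕₚ.<-trans (primeAt-< i<j) (firstPrimeFrom-≥ (suc (primeAt j)) (primeAt j !))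

prime∣prime : ∀ {p q} → Prime p → Prime q → p ∣ q → p ≡ q
prime∣prime prp prq p∣q = [ (λ p≡1 → ⊥-elim (prime≢1 prp p≡1)) , (λ p≡q → p≡q) ]′
  (prime⇒irreducible prq p∣q)

prime∣^ : ∀ {p q} → Prime p → ∀ n → p ∣ q ℕ.^ n → p ∣ q
prime∣^ pr zero    p∣1 = ⊥-elim (prime≢1 pr (∣1⇒≡1 p∣1))
prime∣^ {q = q} pr (suc n) p∣ = [ (λ x → x) , prime∣^ pr n ]′ (euclidsLemma q (q ℕ.^ n) pr p∣)

primeAt∤codeFrom : ∀ {j i} → j ℕ.< i → ∀ us → ¬ (primeAt j ∣ codeFrom i us)
primeAt∤codeFrom {j} j<i []       p∣1 = prime≢1 (primeAt-prime j) (∣1⇒≡1 p∣1)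
primeAt∤codeFrom {j} {i} j<i (u ∷ us) p∣ =
  [ (λ p∣^ → ℕₚ.<⇒≢ (primeAt-< j<i)
      (prime∣prime (primeAt-prime j) (primeAt-prime i) (prime∣^ (primeAt-prime j) (suc u) p∣^)))
  , primeAt∤codeFrom (ℕₚ.m<n⇒m<1+n j<i) us ]′
  (euclidsLemma (primeAt i ℕ.^ suc u) (codeFrom (suc i) us) (primeAt-prime j) p∣)

-- Factors `p` are cancelled one at a time. As `p` divides neither cofactor, both sides run out of
-- them at the same moment.
prime^*-injective : ∀ {p} → Prime p → ∀ u v {a b} → ¬ (p ∣ a) → ¬ (p ∣ b) →
  p ℕ.^ u ℕ.* a ≡ p ℕ.^ v ℕ.* b → u ≡ v × a ≡ b
prime^*-injective pr zero zero {a} {b} _ _ eq = refl ,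
  trans (sym (ℕₚ.*-identityˡ a)) (trans eq (ℕₚ.*-identityˡ b))
prime^*-injective {p} pr zero (suc v) {a} {b} p∤a _ eq = ⊥-elim (p∤a
  (subst (p ∣_) (trans (sym (ℕₚ.*-assoc p (p ℕ.^ v) b)) (trans (sym eq) (ℕₚ.*-identityˡ a)))
    (m∣m*n _)))
prime^*-injective {p} pr (suc u) zero {a} {b} _ p∤b eq = ⊥-elim (p∤b
  (subst (p ∣_) (trans (sym (ℕₚ.*-assoc p (p ℕ.^ u) a)) (trans eq (ℕₚ.*-identityˡ b)))
    (m∣m*n _)))
prime^*-injective {p} pr (suc u) (suc v) {a} {b} p∤a p∤b eq =
  let u≡v , a≡b = prime^*-injective pr u v p∤a p∤b (ℕₚ.*-cancelˡ-≡ _ _ p {{prime⇒nonZero pr}}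
        (trans (sym (ℕₚ.*-assoc p (p ℕ.^ u) a)) (trans eq (ℕₚ.*-assoc p (p ℕ.^ v) b))))
  in cong suc u≡v , a≡b

codeFrom-∷≢1 : ∀ i u us → codeFrom i (u ∷ us) ≢ 1
codeFrom-∷≢1 i u us eq = prime≢1 (primeAt-prime i) (∣1⇒≡1 (subst (primeAt i ∣_)
  (trans (sym (ℕₚ.*-assoc (primeAt i) (primeAt i ℕ.^ u) (codeFrom (suc i) us))) eq) (m∣m*n _)))

codeFrom-injective : ∀ i us vs → codeFrom i us ≡ codeFrom i vs → us ≡ vs
codeFrom-injective i []       []       eq = refl
codeFrom-injective i []       (v ∷ vs) eq = ⊥-elim (codeFrom-∷≢1 i v vs (sym eq))
codeFrom-injective i (u ∷ us) []       eq = ⊥-elim (codeFrom-∷≢1 i u us eq)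
codeFrom-injective i (u ∷ us) (v ∷ vs) eq =
  let u≡v , eq′ = prime^*-injective (primeAt-prime i) (suc u) (suc v)
        (primeAt∤codeFrom ℕₚ.≤-refl us) (primeAt∤codeFrom ℕₚ.≤-refl vs) eq
  in cong₂ _∷_ (ℕₚ.suc-injective u≡v) (codeFrom-injective (suc i) us vs eq′)

-- The list found by `isCode?` is the given one because the coding is injective.
⦅⟨⟩⦆ : ∀ us s → ⟨ us ⟩ ≡ s → ∀ i → ⦅ s ⦆ i ≡ entry us i
⦅⟨⟩⦆ us s eq i with isCode? s
... | yes (vs , eq′) = cong (λ ws → entry ws i) (codeFrom-injective 0 vs us (trans eq′ (sym eq)))
... | no  ∄          = ⊥-elim (∄ (us , eq))

-- Abstract, since unfolding codes makes the type checker factorise numbers.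
abstract
  pair : ℕ → ℕ → ℕ
  pair m n = ⟨ m ∷ n ∷ [] ⟩

  pair₀ : ∀ m n → ⦅ pair m n ⦆ 0 ≡ m
  pair₀ m n = ⦅⟨⟩⦆ (m ∷ n ∷ []) _ refl 0

  pair₁ : ∀ m n → ⦅ pair m n ⦆ 1 ≡ n
  pair₁ m n = ⦅⟨⟩⦆ (m ∷ n ∷ []) _ refl 1

prefix : ℕ → (ℕ → ℕ) → List ℕ
prefix zero    α = []
prefix (suc k) α = α 0 ∷ prefix k (λ i → α (suc i))

entry-prefix : ∀ k α i → i ℕ.< k → entry (prefix k α) i ≡ α i
entry-prefix (suc k) α zero    _           = refl
entry-prefix (suc k) α (suc i) (ℕ.s≤s i<k) = entry-prefix k (λ i → α (suc i)) i i<k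

Agree : ℕ → (ℕ → ℕ) → (ℕ → ℕ) → Set
Agree k α β = ∀ i → i ℕ.< k → α i ≡ β i

abstract
  prefixCode : ℕ → (ℕ → ℕ) → ℕ
  prefixCode k α = ⟨ prefix k α ⟩

  prefixCode-agree : ∀ k α → Agree k (⦅ prefixCode k α ⦆_) α
  prefixCode-agree k α i i<k = trans (⦅⟨⟩⦆ (prefix k α) _ refl i) (entry-prefix k α i i<k)

-- A ball of radius 0/1, hence empty. It fills the entries of an open code that are to contribute
-- nothing.
emptyCode : ℕ
emptyCode = pair 0 (pair 0 0)

-- The order of countable ordinals

≈ₒ-refl : ∀ {ζ} → ζ ≈ₒ ζ
≈ₒ-refl {ζ} = ≤ₒ-refl ζ , ≤ₒ-refl ζ

≈ₒ-sym : ∀ {ζ ξ} → ζ ≈ₒ ξ → ξ ≈ₒ ζ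
≈ₒ-sym (ζ≤ξ , ξ≤ζ) = ξ≤ζ , ζ≤ξ

≈ₒ-trans : ∀ {ζ η ξ} → ζ ≈ₒ η → η ≈ₒ ξ → ζ ≈ₒ ξ
≈ₒ-trans {ζ} {η} {ξ} (a , b) (c , d) = ≤ₒ-trans {ζ} {η} {ξ} a c , ≤ₒ-trans {ξ} {η} {ζ} d b

≤-<ₒ-trans : ∀ {ζ η ξ} → ζ ≤ₒ η → η <ₒ ξ → ζ <ₒ ξ
≤-<ₒ-trans {ζ} {η} {lsub g} ζ≤η (n , η≤gn) = n , ≤ₒ-trans {ζ} {η} {g n} ζ≤η η≤gn

<-≤ₒ-trans : ∀ {ζ η ξ} → ζ <ₒ η → η ≤ₒ ξ → ζ <ₒ ξ
<-≤ₒ-trans {ζ} {lsub f} {lsub g} (m , ζ≤fm) η≤ξ =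
  let n , fm≤gn = η≤ξ m in n , ≤ₒ-trans {ζ} {f m} {g n} ζ≤fm fm≤gn

branch-<ₒ : ∀ f n → f n <ₒ lsub f
branch-<ₒ f n = n , ≤ₒ-refl (f n)

<⇒≤ₒ : ∀ {ζ ξ} → ζ <ₒ ξ → ζ ≤ₒ ξ
<⇒≤ₒ {zeroₒ}  {lsub g} _ = tt
<⇒≤ₒ {lsub f} {lsub g} (n , p) = λ m →
  n , <⇒≤ₒ {f m} {g n} (<-≤ₒ-trans {f m} {lsub f} {g n} (branch-<ₒ f m) p)

<ₒ-sucₒ : ∀ ζ → ζ <ₒ sucₒ ζ
<ₒ-sucₒ ζ = 0 , ≤ₒ-refl ζ

sucₒ-≤ : ∀ {ζ ξ} → ζ <ₒ ξ → sucₒ ζ ≤ₒ ξ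
sucₒ-≤ {ξ = lsub g} ζ<ξ _ = ζ<ξ

sucₒ-mono : ∀ {ζ ξ} → ζ ≤ₒ ξ → sucₒ ζ ≤ₒ sucₒ ξ
sucₒ-mono ζ≤ξ _ = 0 , ζ≤ξ

1≤sucₒ : ∀ ζ → oneₒ ≤ₒ sucₒ ζ
1≤sucₒ ζ _ = 0 , tt

1≤⇒2≤ : ∀ {ζ ξ} → oneₒ ≤ₒ ζ → ζ <ₒ ξ → twoₒ ≤ₒ ξ
1≤⇒2≤ {ζ} {ξ} 1≤ζ ζ<ξ = sucₒ-≤ {oneₒ} {ξ} (≤-<ₒ-trans {oneₒ} {ζ} {ξ} 1≤ζ ζ<ξ)

1≤2 : oneₒ ≤ₒ twoₒ
1≤2 = 1≤sucₒ oneₒ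

2≰1 : ¬ (twoₒ ≤ₒ oneₒ)
2≰1 2≤1 = proj₂ (2≤1 0)

<ₒ⇒1≤ : ∀ {ζ ξ} → ζ <ₒ ξ → oneₒ ≤ₒ ξ
<ₒ⇒1≤ {ξ = lsub g} (n , _) _ = n , tt

0or1≤ : ∀ ζ → ζ ≈ₒ zeroₒ ⊎ oneₒ ≤ₒ ζ
0or1≤ zeroₒ    = inj₁ (tt , tt)
0or1≤ (lsub f) = inj₂ λ _ → 0 , tt

-- An enumeration of the ordinals up to `ζ`, modulo `≈ₒ`: a number codes a finite path down the
-- tree, 0 being the empty path and `suc k` a branch together with a path in its subtree.
initial : Ord → ℕ → Ord
initial ζ        zero    = ζ
initial zeroₒ    (suc _) = zeroₒ
initial (lsub f) (suc k) = initial (f (⦅ k ⦆ 0)) (⦅ k ⦆ 1)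

initial-≤ : ∀ ζ k → initial ζ k ≤ₒ ζ
initial-≤ ζ        zero    = ≤ₒ-refl ζ
initial-≤ zeroₒ    (suc _) = tt
initial-≤ (lsub f) (suc k) = <⇒≤ₒ {initial (f (⦅ k ⦆ 0)) (⦅ k ⦆ 1)} {lsub f}
  (⦅ k ⦆ 0 , initial-≤ (f (⦅ k ⦆ 0)) (⦅ k ⦆ 1))

below : Ord → ℕ → Ord
-- Nothing lies below `zeroₒ`, so this is a dummy value.
below zeroₒ    _ = zeroₒ
below (lsub f) k = initial (f (⦅ k ⦆ 0)) (⦅ k ⦆ 1)

below-< : ∀ {ξ} → oneₒ ≤ₒ ξ → ∀ k → below ξ k <ₒ ξ
below-< {zeroₒ} 1≤ξ = ⊥-elim 1≤ξ
below-< {lsub f} 1≤ξ k = ⦅ k ⦆ 0 , initial-≤ (f (⦅ k ⦆ 0)) (⦅ k ⦆ 1)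

-- Basic open sets of the Baire space

1/1+-strict : ∀ n → 1/1+ suc n ℚ.< 1/1+ n
1/1+-strict n rewrite 1/1+-canonical n | 1/1+-canonical (suc n) =
  *<* (ℤ.+<+ (ℕₚ.+-monoˡ-< 0 (ℕₚ.n<1+n (suc n))))

<⇒gap : ∀ {a b} → a ℚ.< b → ∃[ ε ] 0ℚ ℚ.< ε × a ℚ.+ ε ℚ.< b
<⇒gap {a} {b} a<b =
  let c , a<c , c<b = ℚₚ.<-dense a<b
  in c ℚ.- a ,
     subst (ℚ._< c ℚ.- a) (ℚₚ.+-inverseʳ a) (ℚₚ.+-monoˡ-< (ℚ.- a) a<c) ,
     subst (ℚ._< b) (trans (sym (ℚ-group.\\-leftDividesˡ a c))
         (cong (a ℚ.+_) (ℚₚ.+-comm (ℚ.- a) c))) c<b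

lesser-gap : ∀ {ε ε′} → 0ℚ ℚ.< ε → 0ℚ ℚ.< ε′ → ∃[ δ ] 0ℚ ℚ.< δ × δ ℚ.≤ ε × δ ℚ.≤ ε′
lesser-gap {ε} {ε′} 0<ε 0<ε′ with ℚₚ.≤-total ε ε′
... | inj₁ ε≤ε′ = ε , 0<ε , ℚₚ.≤-refl , ε≤ε′
... | inj₂ ε′≤ε = ε′ , 0<ε′ , ε′≤ε , ℚₚ.≤-refl

1/1+-cancel-< : ∀ {m n} → 1/1+ m ℚ.< 1/1+ n → n ℕ.< m
1/1+-cancel-< {m} {n} lt with ℕₚ.≤-<-connex m n
... | inj₁ m≤n = ⊥-elim (ℚₚ.<-irrefl refl (ℚₚ.<-≤-trans lt (1/1+-anti m≤n)))
... | inj₂ n<m = n<m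

firstDiff-agree : ∀ α β m → Agree (firstDiff α β m) α β
firstDiff-agree α β (suc m) i i< with α 0 ℕₚ.≟ β 0
firstDiff-agree α β (suc m) zero    _          | yes eq = eq
firstDiff-agree α β (suc m) (suc i) (ℕ.s≤s i<) | yes eq =
  firstDiff-agree (α ∘ suc) (β ∘ suc) m i i<

≤firstDiff : ∀ {α β} k m → k ℕ.≤ m → Agree k α β → k ℕ.≤ firstDiff α β m
≤firstDiff zero    m       _           _     = ℕ.z≤n
≤firstDiff {α} {β} (suc k) (suc m) (ℕ.s≤s k≤m) agree with α 0 ℕₚ.≟ β 0
... | yes _ = ℕ.s≤s (≤firstDiff k m k≤m λ i i<k → agree (suc i) (ℕ.s≤s i<k))
... | no ≢₀ = ⊥-elim (≢₀ (agree 0 (ℕ.s≤s ℕ.z≤n)))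

-- The ultrametric property of the Baire space: moving a point within a cylinder changes its
-- distance to `γ` only if `γ` belongs to that cylinder too.
firstDiff-agreeˡ : ∀ {α β} γ k m → k ℕ.≤ m → Agree k α β →
  firstDiff α γ m ≡ firstDiff β γ m ⊎ k ℕ.≤ firstDiff α γ m
firstDiff-agreeˡ γ zero m _ _ = inj₂ ℕ.z≤n
firstDiff-agreeˡ {α} {β} γ (suc k) (suc m) (ℕ.s≤s k≤m) agree
  with α 0 ℕₚ.≟ γ 0 | β 0 ℕₚ.≟ γ 0
... | no _  | no _  = inj₁ refl
... | yes p | no ¬p = ⊥-elim (¬p (trans (sym (agree 0 (ℕ.s≤s ℕ.z≤n))) p))
... | no ¬p | yes p = ⊥-elim (¬p (trans (agree 0 (ℕ.s≤s ℕ.z≤n)) p))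
... | yes _ | yes _
  with firstDiff-agreeˡ {α ∘ suc} {β ∘ suc} (γ ∘ suc) k m k≤m
         (λ i i<k → agree (suc i) (ℕ.s≤s i<k))
...   | inj₁ eq = inj₁ (cong suc eq)
...   | inj₂ k≤ = inj₂ (ℕ.s≤s k≤)

agree⇒dist< : ∀ {k q α β} → 1/1+ k ℚ.< q → Agree k α β → distᴺ α β <ᵣ fromℚ q
agree⇒dist< {k} {q} {α} {β} 1/1+k<q agree =
  let ε , 0<ε , 1/1+k+ε<q = <⇒gap 1/1+k<q
  in ε , 0<ε , k , λ m k≤m →
       ℚₚ.≤-<-trans (ℚₚ.+-monoˡ-≤ ε (1/1+-anti (≤firstDiff {α} {β} k m k≤m agree))) 1/1+k+ε<q

a<a+ε : ∀ a {ε} → 0ℚ ℚ.< ε → a ℚ.< a ℚ.+ ε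
a<a+ε a {ε} 0<ε = subst (ℚ._< a ℚ.+ ε) (ℚₚ.+-identityʳ a) (ℚₚ.+-monoʳ-< a 0<ε)

dist<⇒agree : ∀ {n α β} → distᴺ α β <ᵣ fromℚ (1/1+ n) → Agree (suc n) α β
dist<⇒agree {n} {α} {β} (ε , 0<ε , k , close) i i<1+n =
  firstDiff-agree α β k i (ℕₚ.<-≤-trans i<1+n
    (1/1+-cancel-< {firstDiff α β k} (ℚₚ.<-trans (a<a+ε (1/1+ firstDiff α β k) 0<ε)
      (close k ℕₚ.≤-refl))))

dist<-agree : ∀ {k q α β} γ → 1/1+ k ℚ.< q → Agree k α β →
  distᴺ β γ <ᵣ fromℚ q → distᴺ α γ <ᵣ fromℚ q
dist<-agree {k} {q} {α} {β} γ 1/1+k<q agree (ε , 0<ε , n , close) =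
  let ε′ , 0<ε′ , 1/1+k+ε′<q = <⇒gap 1/1+k<q
      -- The margin has to serve both cases below: an unchanged distance keeps the margin `ε`, and a
      -- distance of at most 1/(k+1) leaves the margin `ε′`.
      δ , 0<δ , δ≤ε , δ≤ε′ = lesser-gap 0<ε 0<ε′
  in δ , 0<δ , n ℕ.⊔ k , λ m ≤m →
       [ (λ eq → ℚₚ.≤-<-trans (ℚₚ.+-mono-≤ (ℚₚ.≤-reflexive (cong 1/1+_ eq)) δ≤ε)
           (close m (ℕₚ.≤-trans (ℕₚ.m≤m⊔n n k) ≤m)))
       , (λ k≤ → ℚₚ.≤-<-trans (ℚₚ.+-mono-≤ (1/1+-anti k≤) δ≤ε′) 1/1+k+ε′<q)
       ]′ (firstDiff-agreeˡ {α} {β} γ k m (ℕₚ.≤-trans (ℕₚ.m≤n⊔m n k) ≤m) agree)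

agree-sym : ∀ {k α β} → Agree k α β → Agree k β α
agree-sym agree i i<k = sym (agree i i<k)

-- Openness in the Baire space in terms of finitely many coordinates, so that later arguments rarely
-- touch the metric.
Local : Pred (ℕ → ℕ) 0ℓ → Set
Local V = ∀ β → β ∈ V → ∃[ k ] (∀ γ → Agree k β γ → γ ∈ V)

Local⇒IsOpen : ∀ {V} → Local V → IsOpen 𝒩 V
Local⇒IsOpen local {β} β∈V = let k , nbhd = local β β∈V in
  1/1+ k , 1/1+-pos k , λ {γ} near →
    nbhd γ (λ i i<k → dist<⇒agree {k} {β} {γ} near i (ℕₚ.m<n⇒m<1+n i<k))

IsOpen⇒Local : ∀ {V} → IsOpen 𝒩 V → Local V
IsOpen⇒Local open-V β β∈V with open-V β∈V
... | ε , 0<ε , ball⊆V with archimedean ε 0<ε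
...   | k , 1/1+k<ε = k , λ γ agree → ball⊆V (agree⇒dist< {k} {ε} {β} {γ} 1/1+k<ε agree)

0<dist : ∀ {α β q} → distᴺ α β <ᵣ fromℚ q → 0ℚ ℚ.< q
0<dist {α} {β} (ε , 0<ε , k , close) = ℚₚ.<-trans (1/1+-pos (firstDiff α β k))
  (ℚₚ.<-trans (a<a+ε (1/1+ firstDiff α β k) 0<ε) (close k ℕₚ.≤-refl))

-- Membership in a ball depends on finitely many coordinates, uniformly in the point, so that balls
-- are clopen. A ball of nonpositive radius is empty and depends on none.
ball-determined : ∀ δ q →
  ∃[ k ] (∀ β γ → Agree k β γ → distᴺ γ δ <ᵣ fromℚ q → distᴺ β δ <ᵣ fromℚ q)
ball-determined δ q with 0ℚ ℚₚ.<? q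
... | no  ≮ = 0 , λ β γ _ near → ⊥-elim (≮ (0<dist {γ} {δ} near))
... | yes 0<q with archimedean q 0<q
...   | k , 1/1+k<q = k , λ β γ agree → dist<-agree {k} {q} {β} {γ} δ 1/1+k<q agree

N-determined : ∀ t → ∃[ k ] (∀ β γ → Agree k β γ → γ ∈ N 𝒩 t → β ∈ N 𝒩 t)
N-determined t = ball-determined (⦅ ⦅ t ⦆ 0 ⦆_) (radius (⦅ t ⦆ 1))

radiusCode : ℕ → ℕ
radiusCode k = pair 1 k

radius-radiusCode : ∀ k → radius (radiusCode k) ≡ 1/1+ k
radius-radiusCode k = cong₂ (λ a b → + a ℚ./ suc b) (pair₀ 1 k) (pair₁ 1 k)

-- The radius is 1/(k+1). As balls are defined by a strict inequality, this fixes the coordinates 0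
-- to `k`, which are `k + 1` many.
cylinder : ℕ → ℕ → ℕ
cylinder s k = pair s (radiusCode k)

∈cylinder⇒agree : ∀ s k {β} → β ∈ N 𝒩 (cylinder s k) → Agree (suc k) β (⦅ s ⦆_)
∈cylinder⇒agree s k {β} β∈ = dist<⇒agree {k} {β} {⦅ s ⦆_}
  (subst₂ (λ s′ q → distᴺ β (⦅ s′ ⦆_) <ᵣ fromℚ q) (pair₀ s (radiusCode k))
    (trans (cong radius (pair₁ s (radiusCode k))) (radius-radiusCode k)) β∈)

agree⇒∈cylinder : ∀ s k {β} → Agree (suc k) β (⦅ s ⦆_) → β ∈ N 𝒩 (cylinder s k)
agree⇒∈cylinder s k {β} agree =
  subst₂ (λ s′ q → distᴺ β (⦅ s′ ⦆_) <ᵣ fromℚ q) (sym (pair₀ s (radiusCode k)))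
    (sym (trans (cong radius (pair₁ s (radiusCode k))) (radius-radiusCode k)))
    (agree⇒dist< {suc k} {_} {β} {⦅ s ⦆_} (1/1+-strict k) agree)

baire-basis : ∀ k β → ∃[ t ] β ∈ N 𝒩 t × (∀ γ → γ ∈ N 𝒩 t → Agree k β γ)
baire-basis k β = cylinder s k , agree⇒∈cylinder s k (agree-sym s-agree) ,
  λ γ γ∈ i i<k → trans (sym (s-agree i (ℕₚ.m<n⇒m<1+n i<k)))
    (sym (∈cylinder⇒agree s k γ∈ i (ℕₚ.m<n⇒m<1+n i<k)))
  where
  s : ℕ
  s = prefixCode (suc k) β

  s-agree : Agree (suc k) (⦅ s ⦆_) β
  s-agree = prefixCode-agree (suc k) β

-- Strict inequalities of reals and rationals

≤-<ᵣ-trans : ∀ x y q → x ≤ᵣ y → y <ᵣ fromℚ q → x <ᵣ fromℚ q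
≤-<ᵣ-trans x y q x≤y (ε , 0<ε , k , close) =
  -- One half of the margin absorbs the slack in `≤ᵣ`, the other half remains as the new margin.
  let δ = ½ ℚ.* ε
      l , near = x≤y δ (half-pos 0<ε)
  in δ , half-pos 0<ε , k ℕ.⊔ l , λ n ≤n → begin-strict
    seq x n ℚ.+ δ         <⟨ ℚₚ.+-monoˡ-< δ (near n (ℕₚ.≤-trans (ℕₚ.m≤n⊔m k l) ≤n)) ⟩
    seq y n ℚ.+ δ ℚ.+ δ   ≡⟨ ℚₚ.+-assoc (seq y n) δ δ ⟩
    seq y n ℚ.+ (δ ℚ.+ δ) ≡⟨ cong (seq y n ℚ.+_) (half+half ε) ⟩
    seq y n ℚ.+ ε         <⟨ close n (ℕₚ.≤-trans (ℕₚ.m≤m⊔n k l) ≤n) ⟩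
    q                     ∎
  where open ℚₚ.≤-Reasoning

+ᵣ-mono-< : ∀ x y a b → x <ᵣ fromℚ a → y <ᵣ fromℚ b → x +ᵣ y <ᵣ fromℚ (a ℚ.+ b)
+ᵣ-mono-< x y a b (ε , 0<ε , k , close) (ε′ , 0<ε′ , l , close′) =
  ε′ , 0<ε′ , k ℕ.⊔ l , λ n ≤n → begin-strict
    seq x n ℚ.+ seq y n ℚ.+ ε′   ≡⟨ ℚₚ.+-assoc (seq x n) (seq y n) ε′ ⟩
    seq x n ℚ.+ (seq y n ℚ.+ ε′) <⟨ ℚₚ.+-mono-< (ℚₚ.<-trans (a<a+ε (seq x n) 0<ε)
                                      (close n (ℕₚ.≤-trans (ℕₚ.m≤m⊔n k l) ≤n)))
                                      (close′ n (ℕₚ.≤-trans (ℕₚ.m≤n⊔m k l) ≤n)) ⟩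
    a ℚ.+ b                      ∎
  where open ℚₚ.≤-Reasoning

<ᵣ-mono : ∀ x {a b} → a ℚ.≤ b → x <ᵣ fromℚ a → x <ᵣ fromℚ b
<ᵣ-mono x a≤b (ε , 0<ε , k , close) = ε , 0<ε , k , λ n k≤n → ℚₚ.<-≤-trans (close n k≤n) a≤b

<ᵣ-gap : ∀ x q → x <ᵣ fromℚ q → ∃[ δ ] 0ℚ ℚ.< δ × x <ᵣ fromℚ (q ℚ.- δ)
<ᵣ-gap x q (ε , 0<ε , k , close) = δ , 0<δ , δ , 0<δ , k , λ n k≤n → begin-strict
    seq x n ℚ.+ δ               ≡⟨ sym (ℚ-group.//-rightDividesʳ δ (seq x n ℚ.+ δ)) ⟩
    seq x n ℚ.+ δ ℚ.+ δ ℚ.- δ   ≡⟨ cong (ℚ._- δ) (ℚₚ.+-assoc (seq x n) δ δ) ⟩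
    seq x n ℚ.+ (δ ℚ.+ δ) ℚ.- δ ≡⟨ cong (λ e → seq x n ℚ.+ e ℚ.- δ) (half+half ε) ⟩
    seq x n ℚ.+ ε ℚ.- δ         <⟨ ℚₚ.+-monoˡ-< (ℚ.- δ) (close n k≤n) ⟩
    q ℚ.- δ                     ∎
  where
  open ℚₚ.≤-Reasoning

  δ : ℚ
  δ = ½ ℚ.* ε

  0<δ : 0ℚ ℚ.< δ
  0<δ = half-pos 0<ε

-- Comparability, least elements and suprema of ordinals

module Classical (em : ∀ {a} → ExcludedMiddle a) where


  -- Excluded middle decides whether some branch of the first tree dominates the second tree. If
  -- none does, recursion with the roles exchanged puts every branch strictly below the second tree.
  ≤ₒ-or-> : ∀ ζ ξ → ζ ≤ₒ ξ ⊎ ξ <ₒ ζ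
  ≤ₒ-or-> zeroₒ    ξ        = inj₁ tt
  ≤ₒ-or-> (lsub f) zeroₒ    = inj₂ (0 , tt)
  ≤ₒ-or-> (lsub f) (lsub g) with em {P = ∃[ m ] lsub g ≤ₒ f m}
  ... | yes (m , p) = inj₂ (m , p)
  ... | no  ∄       = inj₁ λ m → [ (λ p → ⊥-elim (∄ (m , p))) , (λ p → p) ]′
                        (≤ₒ-or-> (lsub g) (f m))

  ≤ₒ-total : ∀ ζ ξ → ζ ≤ₒ ξ ⊎ ξ ≤ₒ ζ
  ≤ₒ-total ζ ξ = [ inj₁ , (λ ξ<ζ → inj₂ (<⇒≤ₒ {ξ} {ζ} ξ<ζ)) ]′ (≤ₒ-or-> ζ ξ)

  1or2≤ : ∀ {ξ} → oneₒ ≤ₒ ξ → ξ ≈ₒ oneₒ ⊎ twoₒ ≤ₒ ξ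
  1or2≤ {ξ} 1≤ξ = [ (λ ξ≤1 → inj₁ (ξ≤1 , 1≤ξ)) , (λ 1<ξ → inj₂ (sucₒ-≤ {oneₒ} {ξ} 1<ξ)) ]′
    (≤ₒ-or-> ξ oneₒ)

  -- An ordinal below `ζ` that is not equal to it lies below some branch, and the search descends
  -- there.
  initial-surjective : ∀ ζ η → η ≤ₒ ζ → ∃[ k ] η ≈ₒ initial ζ k
  initial-surjective ζ η η≤ζ with ≤ₒ-or-> ζ η
  ... | inj₁ ζ≤η = 0 , η≤ζ , ζ≤η
  initial-surjective (lsub f) η _ | inj₂ (m , η≤fm) with initial-surjective (f m) η η≤fm
  ... | j , eq = suc (pair m j) ,
    subst₂ (λ m′ j′ → η ≈ₒ initial (f m′) j′) (sym (pair₀ m j)) (sym (pair₁ m j)) eq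

  below-surjective : ∀ {ξ η} → η <ₒ ξ → ∃[ k ] η ≈ₒ below ξ k
  below-surjective {lsub f} {η} (m , η≤fm) with initial-surjective (f m) η η≤fm
  ... | j , eq = pair m j ,
    subst₂ (λ m′ j′ → η ≈ₒ initial (f m′) j′) (sym (pair₀ m j)) (sym (pair₁ m j)) eq

  IsLeast-exists : {P : Pred Ord p} → ∃ P → ∃ (IsLeast P)
  IsLeast-exists {P = P} (ξ , Pξ) = go ξ (<ₒ-wellFounded ξ) Pξ
    where
    go : ∀ ξ → Acc _<ₒ_ ξ → P ξ → ∃ (IsLeast P)
    go ξ (acc rs) Pξ with em {P = ∃[ ζ ] ζ <ₒ ξ × P ζ}
    ... | yes (ζ , ζ<ξ , Pζ) = go ζ (rs ζ<ξ) Pζ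
    ... | no  ∄ = ξ , Pξ , λ η Pη → [ (λ p → p) , (λ η<ξ → ⊥-elim (∄ (η , η<ξ , Pη))) ]′
                    (≤ₒ-or-> ξ η)

  -- A witness of `P` excludes the default value `zeroₒ` of `least`.
  least-isLeast : {P : Pred Ord p} → ∃ P → IsLeast P (least em P)
  least-isLeast {P = P} ∃P with em {P = ∃ (IsLeast P)}
  ... | yes (_ , isLeast) = isLeast
  ... | no  ∄             = ⊥-elim (∄ (IsLeast-exists ∃P))

  Bounded : Pred Ord p → Set p
  Bounded P = ∃[ ξ ] (∀ ζ → P ζ → ζ ≤ₒ ξ)

  sup-upper : {P : Pred Ord p} → Bounded P → ∀ ζ → P ζ → ζ ≤ₒ sup em P
  sup-upper bounded = proj₁ (least-isLeast bounded)

  sup-least : {P : Pred Ord p} → Bounded P → ∀ ξ → (∀ ζ → P ζ → ζ ≤ₒ ξ) → sup em P ≤ₒ ξ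
  sup-least bounded = proj₂ (least-isLeast bounded)

  sup-mono : {P : Pred Ord p} {Q : Pred Ord q} → Bounded Q →
    (∀ ζ → P ζ → ∃[ ζ′ ] Q ζ′ × ζ ≤ₒ ζ′) → sup em P ≤ₒ sup em Q
  sup-mono {P = P} {Q} bounded P⊑Q = sup-least (sup em Q , below-sup) (sup em Q) below-sup
    where
    below-sup : ∀ ζ → P ζ → ζ ≤ₒ sup em Q
    below-sup ζ Pζ = let ζ′ , Qζ′ , ζ≤ζ′ = P⊑Q ζ Pζ in
      ≤ₒ-trans {ζ} {ζ′} {sup em Q} ζ≤ζ′ (sup-upper bounded ζ′ Qζ′)

  max-bounded : ∀ ζ η → Bounded (λ ξ → ξ ≡ ζ ⊎ ξ ≡ η)
  max-bounded ζ η = [ (λ ζ≤η → η , λ where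
                          _ (inj₁ refl) → ζ≤η
                          _ (inj₂ refl) → ≤ₒ-refl η)
                    , (λ η≤ζ → ζ , λ where
                          _ (inj₁ refl) → ≤ₒ-refl ζ
                          _ (inj₂ refl) → η≤ζ) ]′ (≤ₒ-total ζ η)

  ≤-maxˡ : ∀ ζ η → ζ ≤ₒ max em ζ η
  ≤-maxˡ ζ η = sup-upper (max-bounded ζ η) ζ (inj₁ refl)

  ≤-maxʳ : ∀ ζ η → η ≤ₒ max em ζ η
  ≤-maxʳ ζ η = sup-upper (max-bounded ζ η) η (inj₂ refl)

  max-mono : ∀ {ζ η ζ′ η′} → ζ ≤ₒ ζ′ → η ≤ₒ η′ → max em ζ η ≤ₒ max em ζ′ η′
  max-mono {ζ} {η} {ζ′} {η′} ζ≤ η≤ = sup-mono (max-bounded ζ′ η′) λ where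
    _ (inj₁ refl) → ζ′ , inj₁ refl , ζ≤
    _ (inj₂ refl) → η′ , inj₂ refl , η≤

  -- The Borel hierarchy on 𝒩

  stable : ∀ {a} {Q : Set a} → ¬ ¬ Q → Q
  stable = decidable-stable em

  Σ-≐ : A ≐ A′ → Σ⁰ 𝒩 ξ A → Σ⁰ 𝒩 ξ A′
  Σ-≐ (A⊆ , A′⊆) (isOpen ξ≈1 open-A) = isOpen ξ≈1 λ x∈A′ →
    let ε , 0<ε , ball⊆ = open-A (A′⊆ x∈A′) in ε , 0<ε , λ y∈ → A⊆ (ball⊆ y∈)
  Σ-≐ (A⊆ , A′⊆) (union 2≤ξ P Π-P (A⊆⋃ , ⋃⊆A)) =
    union 2≤ξ P Π-P ((λ x∈ → A⊆⋃ (A′⊆ x∈)) , (λ x∈ → A⊆ (⋃⊆A x∈)))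

  Π-≐ : A ≐ A′ → Π⁰ 𝒩 ξ A → Π⁰ 𝒩 ξ A′
  Π-≐ (A⊆ , A′⊆) (complement B Σ-B (A⊆∁ , ∁⊆A)) =
    complement B Σ-B ((λ x∈ → A⊆∁ (A′⊆ x∈)) , (λ x∉ → A⊆ (∁⊆A x∉)))

  Σ⇒1≤ : Σ⁰ 𝒩 ξ A → oneₒ ≤ₒ ξ
  Σ⇒1≤ (isOpen (_ , 1≤ξ) _)       = 1≤ξ
  Σ⇒1≤ {ξ} (union 2≤ξ _ _ _) = ≤ₒ-trans {oneₒ} {twoₒ} {ξ} 1≤2 2≤ξ

  Π⇒1≤ : Π⁰ 𝒩 ξ A → oneₒ ≤ₒ ξ
  Π⇒1≤ (complement _ Σ-B _) = Σ⇒1≤ Σ-B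

  2≤∧≈1⇒⊥ : twoₒ ≤ₒ ξ → ξ ≈ₒ oneₒ → ⊥
  2≤∧≈1⇒⊥ {ξ} 2≤ξ (ξ≤1 , _) = 2≰1 (≤ₒ-trans {twoₒ} {ξ} {oneₒ} 2≤ξ ξ≤1)

  -- From rank 2 on an open set has to be presented as a union of closed sets. The basic sets inside
  -- `V` serve, since they are clopen; `Q t` is the basic set `t` if it lies inside `V`, and empty
  -- otherwise.
  open⇒Σ₂ : Local V → twoₒ ≤ₒ ξ → Σ⁰ 𝒩 ξ V
  open⇒Σ₂ {V} {ξ} local 2≤ξ = union 2≤ξ Q Π-Q ((λ {β} → V⊆⋃ {β}) , λ (t , β∈ , N⊆V) → N⊆V β∈)
    where
    Q : ℕ → Pred (ℕ → ℕ) 0ℓ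
    Q t β = β ∈ N 𝒩 t × (∀ {γ} → γ ∈ N 𝒩 t → γ ∈ V)

    ∁Q-local : ∀ t → Local (∁ (Q t))
    ∁Q-local t β β∉Q = let k , determined = N-determined t in
      k , λ γ agree (γ∈N , N⊆V) → β∉Q (determined β γ agree γ∈N , N⊆V)

    Π-Q : ∀ t → ∃[ ζ ] oneₒ ≤ₒ ζ × ζ <ₒ ξ × Π⁰ 𝒩 ζ (Q t)
    Π-Q t = oneₒ , ≤ₒ-refl oneₒ , <-≤ₒ-trans {oneₒ} {twoₒ} {ξ} (<ₒ-sucₒ oneₒ) 2≤ξ ,
      complement (∁ (Q t)) (isOpen ≈ₒ-refl (Local⇒IsOpen (∁Q-local t))) ((λ q ¬q → ¬q q) , stable)

    V⊆⋃ : V ⊆ ⋃ ℕ Q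
    V⊆⋃ {β} β∈V = let k , nbhd = local β β∈V
                      t , β∈N , N⇒agree = baire-basis k β
                  in t , β∈N , λ {γ} γ∈N → nbhd γ (N⇒agree γ γ∈N)

  open⇒Σ : oneₒ ≤ₒ ξ → Local V → Σ⁰ 𝒩 ξ V
  open⇒Σ 1≤ξ local with 1or2≤ 1≤ξ
  ... | inj₁ ξ≈1 = isOpen ξ≈1 (Local⇒IsOpen local)
  ... | inj₂ 2≤ξ = open⇒Σ₂ local 2≤ξ

  Σ-const : oneₒ ≤ₒ ξ → (Q : Set) → Σ⁰ 𝒩 ξ (λ _ → Q)
  Σ-const 1≤ξ Q = open⇒Σ 1≤ξ λ _ q → 0 , λ _ _ → q

  Σ-coordinates : oneₒ ≤ₒ ξ → ∀ k (A : Pred (ℕ → ℕ) 0ℓ) →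
    (∀ β γ → Agree k β γ → A β → A γ) → Σ⁰ 𝒩 ξ A
  Σ-coordinates 1≤ξ k A A-resp = open⇒Σ 1≤ξ λ β β∈A → k , λ γ agree → A-resp β γ agree β∈A

  Σ-mono : ζ ≤ₒ ξ → Σ⁰ 𝒩 ζ A → Σ⁰ 𝒩 ξ A
  Σ-mono {ζ} {ξ} ζ≤ξ Σ-A@(isOpen (_ , 1≤ζ) open-A) =
    open⇒Σ (≤ₒ-trans {oneₒ} {ζ} {ξ} 1≤ζ ζ≤ξ) (IsOpen⇒Local open-A)
  Σ-mono {ζ} {ξ} ζ≤ξ (union 2≤ζ P Π-P A≐) = union (≤ₒ-trans {twoₒ} {ζ} {ξ} 2≤ζ ζ≤ξ) P
    (λ n → let η , 1≤η , η<ζ , Π-Pn = Π-P n in η , 1≤η , <-≤ₒ-trans {η} {ζ} {ξ} η<ζ ζ≤ξ , Π-Pn) A≐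

  Π-mono : ζ ≤ₒ ξ → Π⁰ 𝒩 ζ A → Π⁰ 𝒩 ξ A
  Π-mono {ζ} {ξ} ζ≤ξ (complement B Σ-B A≐) = complement B (Σ-mono {ζ} {ξ} ζ≤ξ Σ-B) A≐

  Π⇒Σ : ζ <ₒ ξ → Π⁰ 𝒩 ζ A → Σ⁰ 𝒩 ξ A
  Π⇒Σ {ζ} {ξ} {A} ζ<ξ Π-A = union (1≤⇒2≤ {ζ} {ξ} (Π⇒1≤ Π-A) ζ<ξ) (λ _ → A)
    (λ _ → ζ , Π⇒1≤ Π-A , ζ<ξ , Π-A) ((λ x∈A → 0 , x∈A) , proj₂)

  Σ₁⇒Local : ξ ≈ₒ oneₒ → Σ⁰ 𝒩 ξ A → Local A
  Σ₁⇒Local ξ≈1 (isOpen _ open-A)   = IsOpen⇒Local open-A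
  Σ₁⇒Local ξ≈1 (union 2≤ξ _ _ _) = ⊥-elim (2≤∧≈1⇒⊥ 2≤ξ ξ≈1)

  Σ⇒⋃Π : twoₒ ≤ₒ ξ → Σ⁰ 𝒩 ξ A → Σ[ P ∈ (ℕ → Pred (ℕ → ℕ) 0ℓ) ]
    (∀ n → ∃[ ζ ] oneₒ ≤ₒ ζ × ζ <ₒ ξ × Π⁰ 𝒩 ζ (P n)) × A ≐ ⋃ ℕ P
  Σ⇒⋃Π 2≤ξ (isOpen ξ≈1 _)      = ⊥-elim (2≤∧≈1⇒⊥ 2≤ξ ξ≈1)
  Σ⇒⋃Π 2≤ξ (union _ P Π-P A≐) = P , Π-P , A≐

  Σ-⋃ : (∀ n → Σ⁰ 𝒩 ξ (P n)) → Σ⁰ 𝒩 ξ (⋃ ℕ P)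
  Σ-⋃ {ξ} {P} Σ-P with 1or2≤ (Σ⇒1≤ (Σ-P 0))
  ... | inj₁ ξ≈1 = isOpen ξ≈1 (Local⇒IsOpen λ β (n , β∈Pn) →
          let k , nbhd = Σ₁⇒Local ξ≈1 (Σ-P n) β β∈Pn in k , λ γ agree → n , nbhd γ agree)
  ... | inj₂ 2≤ξ = union 2≤ξ (λ k → Q (⦅ k ⦆ 0) (⦅ k ⦆ 1)) (λ k → Π-Q (⦅ k ⦆ 0) (⦅ k ⦆ 1))
          ( (λ {β} (n , β∈Pn) → let m , β∈Q = proj₁ (P≐ n) β∈Pn in
               pair n m , subst₂ (λ i j → Q i j β) (sym (pair₀ n m)) (sym (pair₁ n m)) β∈Q)
          , (λ (k , β∈Q) → ⦅ k ⦆ 0 , proj₂ (P≐ (⦅ k ⦆ 0)) (⦅ k ⦆ 1 , β∈Q)))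
    where
    Q : ℕ → ℕ → Pred (ℕ → ℕ) 0ℓ
    Q n = proj₁ (Σ⇒⋃Π 2≤ξ (Σ-P n))

    Π-Q : ∀ n m → ∃[ ζ ] oneₒ ≤ₒ ζ × ζ <ₒ ξ × Π⁰ 𝒩 ζ (Q n m)
    Π-Q n = proj₁ (proj₂ (Σ⇒⋃Π 2≤ξ (Σ-P n)))

    P≐ : ∀ n → P n ≐ ⋃ ℕ (Q n)
    P≐ n = proj₂ (proj₂ (Σ⇒⋃Π 2≤ξ (Σ-P n)))

  either : Pred (ℕ → ℕ) 0ℓ → Pred (ℕ → ℕ) 0ℓ → ℕ → Pred (ℕ → ℕ) 0ℓ
  either A B zero    = A
  either A B (suc _) = B

  Σ-∪ : ∀ {B} → Σ⁰ 𝒩 ξ A → Σ⁰ 𝒩 ξ B → Σ⁰ 𝒩 ξ (A ∪ B)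
  Σ-∪ {ξ} {A} {B} Σ-A Σ-B = Σ-≐ ((λ where
        (zero  , x∈A) → inj₁ x∈A
        (suc _ , x∈B) → inj₂ x∈B) , [ (λ x∈A → 0 , x∈A) , (λ x∈B → 1 , x∈B) ]′)
    (Σ-⋃ {P = either A B} λ where
        zero    → Σ-A
        (suc _) → Σ-B)

  Π-∩ : ∀ {B} → Π⁰ 𝒩 ξ A → Π⁰ 𝒩 ξ B → Π⁰ 𝒩 ξ (A ∩ B)
  Π-∩ (complement A′ Σ-A′ (A⊆ , A⊇)) (complement B′ Σ-B′ (B⊆ , B⊇)) =
    complement (A′ ∪ B′) (Σ-∪ Σ-A′ Σ-B′)
      ( (λ (x∈A , x∈B) → [ A⊆ x∈A , B⊆ x∈B ]′)
      , (λ x∉ → A⊇ (x∉ ∘ inj₁) , B⊇ (x∉ ∘ inj₂)))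

  -- Intersection distributes over the two countable unions, and two of their pieces meet at the
  -- larger of their ranks, which is still below `ξ`.
  Σ-∩ : ∀ {B} → Σ⁰ 𝒩 ξ A → Σ⁰ 𝒩 ξ B → Σ⁰ 𝒩 ξ (A ∩ B)
  Σ-∩ {ξ} {A} {B} Σ-A Σ-B with 1or2≤ (Σ⇒1≤ Σ-A)
  ... | inj₁ ξ≈1 = isOpen ξ≈1 (Local⇒IsOpen λ β (β∈A , β∈B) →
          let k , nbhd = Σ₁⇒Local ξ≈1 Σ-A β β∈A
              l , nbhd′ = Σ₁⇒Local ξ≈1 Σ-B β β∈B
          in k ℕ.⊔ l , λ γ agree →
               nbhd γ (λ i i<k → agree i (ℕₚ.<-≤-trans i<k (ℕₚ.m≤m⊔n k l))) ,
               nbhd′ γ (λ i i<l → agree i (ℕₚ.<-≤-trans i<l (ℕₚ.m≤n⊔m k l))))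
  ... | inj₂ 2≤ξ with Σ⇒⋃Π 2≤ξ Σ-A | Σ⇒⋃Π 2≤ξ Σ-B
  ...   | P , Π-P , A⊆ , A⊇ | Q , Π-Q , B⊆ , B⊇ =
          Σ-≐ ((λ (n , m , x∈P , x∈Q) → A⊇ (n , x∈P) , B⊇ (m , x∈Q))
              , λ (x∈A , x∈B) → let n , x∈P = A⊆ x∈A ; m , x∈Q = B⊆ x∈B in n , m , x∈P , x∈Q)
            (Σ-⋃ {P = λ n → ⋃ ℕ λ m → P n ∩ Q m} λ n → Σ-⋃ {P = λ m → P n ∩ Q m} λ m → meet n m)
    where
    meet : ∀ n m → Σ⁰ 𝒩 ξ (P n ∩ Q m)
    meet n m with Π-P n | Π-Q m
    ... | η , 1≤η , η<ξ , Π-Pn | ζ , 1≤ζ , ζ<ξ , Π-Qm with ≤ₒ-total η ζ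
    ...   | inj₁ η≤ζ = Π⇒Σ {ζ} {ξ} ζ<ξ (Π-∩ (Π-mono {η} {ζ} η≤ζ Π-Pn) Π-Qm)
    ...   | inj₂ ζ≤η = Π⇒Σ {η} {ξ} η<ξ (Π-∩ Π-Pn (Π-mono {ζ} {η} ζ≤η Π-Qm))

  Σ-⋂< : ∀ k → oneₒ ≤ₒ ξ → (∀ n → Σ⁰ 𝒩 ξ (P n)) → Σ⁰ 𝒩 ξ (λ β → ∀ i → i ℕ.< k → P i β)
  Σ-⋂< zero 1≤ξ Σ-P = Σ-≐ ((λ _ i ()) , λ _ → tt) (Σ-const 1≤ξ _)
  Σ-⋂< {ξ} {P} (suc k) 1≤ξ Σ-P = Σ-≐
    ( (λ (Q , Pk) i i<1+k → [ Q i , (λ { refl → Pk }) ]′ (ℕₚ.m≤n⇒m<n∨m≡n (ℕₚ.≤-pred i<1+k)))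
    , (λ Q → (λ i i<k → Q i (ℕₚ.m<n⇒m<1+n i<k)) , Q k ℕₚ.≤-refl))
    (Σ-∩ (Σ-⋂< {ξ} {P} k 1≤ξ Σ-P) (Σ-P k))

  ∁-Π : Σ⁰ 𝒩 ξ A → Π⁰ 𝒩 ξ (∁ A)
  ∁-Π {A = A} Σ-A = complement A Σ-A ((λ x → x) , (λ x → x))

  -- The rank is left open, so that complements may raise it freely. Existence of some rank is all
  -- that is required for `rbc` to be a genuine minimum.
  Borel : Pred (ℕ → ℕ) 0ℓ → Set₁
  Borel A = ∃[ ξ ] Σ⁰ 𝒩 ξ A

  Borel-≐ : A ≐ A′ → Borel A → Borel A′
  Borel-≐ A≐A′ (ξ , Σ-A) = ξ , Σ-≐ A≐A′ Σ-A

  Borel-∁ : Borel A → Borel (∁ A)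
  Borel-∁ (ξ , Σ-A) = sucₒ ξ , Π⇒Σ {ξ} {sucₒ ξ} (<ₒ-sucₒ ξ) (∁-Π Σ-A)

  Borel-⋃ : (∀ n → Borel (P n)) → Borel (⋃ ℕ P)
  Borel-⋃ Borel-P = lsub (proj₁ ∘ Borel-P) , Σ-⋃ λ n →
    Σ-mono {proj₁ (Borel-P n)} (<⇒≤ₒ {proj₁ (Borel-P n)} (branch-<ₒ (proj₁ ∘ Borel-P) n))
      (proj₂ (Borel-P n))

  Borel-∪ : ∀ {B} → Borel A → Borel B → Borel (A ∪ B)
  Borel-∪ {A} {B} Borel-A Borel-B = Borel-≐ ((λ where
        (zero  , x∈A) → inj₁ x∈A
        (suc _ , x∈B) → inj₂ x∈B) , [ (λ x∈A → 0 , x∈A) , (λ x∈B → 1 , x∈B) ]′)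
    (Borel-⋃ {either A B} λ where
        zero    → Borel-A
        (suc _) → Borel-B)

  Borel-⋂ : (∀ n → Borel (P n)) → Borel (λ β → ∀ n → P n β)
  Borel-⋂ {P} Borel-P = Borel-≐
    ((λ ¬∃ n → stable λ ¬Pn → ¬∃ (n , ¬Pn)) , (λ all (n , ¬Pn) → ¬Pn (all n)))
    (Borel-∁ (Borel-⋃ {λ n → ∁ (P n)} λ n → Borel-∁ (Borel-P n)))

  Borel-∩ : ∀ {B} → Borel A → Borel B → Borel (A ∩ B)
  Borel-∩ {A} {B} Borel-A Borel-B = Borel-≐
    ((λ x∉ → stable (x∉ ∘ inj₁) , stable (x∉ ∘ inj₂)) ,
      (λ (x∈A , x∈B) → [ (λ x∉ → x∉ x∈A) , (λ x∉ → x∉ x∈B) ]′))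
    (Borel-∁ (Borel-∪ (Borel-∁ Borel-A) (Borel-∁ Borel-B)))

  Borel-⇒ : ∀ {B} → Borel A → Borel B → Borel (λ x → A x → B x)
  Borel-⇒ {A} {B} Borel-A Borel-B = Borel-≐
    ((λ where
        (inj₁ x∉A) x∈A → ⊥-elim (x∉A x∈A)
        (inj₂ x∈B) _   → x∈B) ,
     λ {x} f → [ (λ x∈A → inj₂ (f x∈A)) , inj₁ ]′ (dec x))
    (Borel-∪ (Borel-∁ Borel-A) Borel-B)
    where
    dec : ∀ x → A x ⊎ ¬ A x
    dec x with em {P = A x}
    ... | yes x∈A = inj₁ x∈A
    ... | no  x∉A = inj₂ x∉A

  Borel-const : (Q : Set) → Borel (λ _ → Q)
  Borel-const Q = oneₒ , Σ-const (≤ₒ-refl oneₒ) Q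

  Borel⇒Π : Borel A → ∃[ ξ ] Π⁰ 𝒩 ξ A
  Borel⇒Π Borel-A = let ξ , Σ-∁A = Borel-∁ Borel-A in
    ξ , complement _ Σ-∁A ((λ x∈A x∉A → x∉A x∈A) , stable)

  -- Values of {α *}, and the functions rbc and apb

  N-resp-≡ : ∀ {c ℓ} (X : Presentation c ℓ) {s t} x → s ≡ t → x ∈ N X s → x ∈ N X t
  N-resp-≡ X x refl x∈N = x∈N

  U-resp-≗ : ∀ {c ℓ} (X : Presentation c ℓ) {α α′} x → α ≗ α′ → x ∈ U X α → x ∈ U X α′
  U-resp-≗ X x α≗α′ (n , x∈N) = n , N-resp-≡ X x (α≗α′ n) x∈N

  -- Wrapped in records, because the unfolded forms of these relations defeat unification.
  record Contains (n s : ℕ) (α : ℕ → ℕ) : Set where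
    constructor contains
    field ∈U : (n , s) ∈ U ω×ω (α *)

  record Value (n : ℕ) (α β : ℕ → ℕ) : Set where
    constructor mkValue
    field
      ⇒Contains : ∀ s → β ∈ N 𝒩 s → Contains n s α
      Contains⇒ : ∀ s → Contains n s α → β ∈ N 𝒩 s
  open Value

  Contains-resp-≗ : ∀ {n s α α′} → α ≗ α′ → Contains n s α → Contains n s α′
  Contains-resp-≗ {n} {s} {α} {α′} α≗α′ (contains ∈U) =
    contains (U-resp-≗ ω×ω {α *} {α′ *} (n , s) (λ i → α≗α′ (suc i)) ∈U)

  Contains-local : ∀ n s → Local (Contains n s)
  Contains-local n s β (contains (m , ∈N)) = suc (suc m) , λ γ agree →
    contains (m , N-resp-≡ ω×ω (n , s) (agree (suc m) ℕₚ.≤-refl) ∈N)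

  Value-unique : ∀ {n α α′ β β′} → α ≗ α′ → Value n α β → Value n α′ β′ → β ≗ β′
  Value-unique {β = β} {β′} α≗α′ v v′ i =
    let t , β∈N , N⇒agree = baire-basis (suc i) β
    in N⇒agree β′ (Contains⇒ v′ t (Contains-resp-≗ α≗α′ (⇒Contains v t β∈N))) i ℕₚ.≤-refl

  Value-resp-≗ : ∀ {n α α′ β} → α ≗ α′ → Value n α β → Value n α′ β
  Value-resp-≗ α≗α′ v = mkValue
    (λ s β∈N → Contains-resp-≗ α≗α′ (⇒Contains v s β∈N))
    (λ s ∋s → Contains⇒ v s (Contains-resp-≗ (λ i → sym (α≗α′ i)) ∋s))

  IsValue⇒Value : ∀ n α β → IsValue (α *) n β → Value n α β
  IsValue⇒Value n α β v = mkValue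
    (λ s β∈N → contains (Equivalence.to (v s) β∈N))
    (λ s (contains ∈U) → Equivalence.from (v s) ∈U)

  ↓⇒Value : ∀ n α β → ⟪ α * ⟫ n ↓ β → Value n α β
  ↓⇒Value n α β (v , _) = IsValue⇒Value n α β v

  -- Sequences with the same basic neighbourhoods coincide, which gives the uniqueness clause of
  -- `↓`.
  Value⇒↓ : ∀ n α β → Value n α β → ⟪ α * ⟫ n ↓ β
  Value⇒↓ n α β v =
    (λ s → mk⇔ (λ β∈N → Contains.∈U (⇒Contains v s β∈N)) (λ ∈U → Contains⇒ v s (contains ∈U))) ,
    λ β′ v′ → Value-unique (λ _ → refl) (IsValue⇒Value n α β′ v′) v

  Represents : ℕ → Pred (ℕ → ℕ) 0ℓ → Pred (ℕ → ℕ) 0ℓ → Set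
  Represents n W A = ∀ α β → Value n α β → (A β → W α) × (W α → A β)

  -- An open set `A` pulls back to the condition that some basic subset of `A` is listed for `n`,
  -- which is open in `α` even where `{α *}(n)` is undefined. Unions and complements follow at the
  -- same rank, because `Represents` compares the sets only where the value exists.
  pullback : ∀ n → Σ⁰ 𝒩 ξ A → Σ[ W ∈ Pred (ℕ → ℕ) 0ℓ ] Σ⁰ 𝒩 ξ W × Represents n W A
  pullbackΠ : ∀ n → Π⁰ 𝒩 ξ A → Σ[ W ∈ Pred (ℕ → ℕ) 0ℓ ] Π⁰ 𝒩 ξ W × Represents n W A

  pullback {ξ} {A} n (isOpen ξ≈1 open-A) =
    W , isOpen ξ≈1 (Local⇒IsOpen λ α (s , N⊆A , ∋s) →
          let k , nbhd = Contains-local n s α ∋s in k , λ γ agree → s , N⊆A , nbhd γ agree) ,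
    λ α β v →
      (λ β∈A → let k , nbhd = IsOpen⇒Local open-A β β∈A
                   t , β∈N , N⇒agree = baire-basis k β
               in t , (λ γ γ∈N → nbhd γ (N⇒agree γ γ∈N)) , ⇒Contains v t β∈N) ,
      (λ (s , N⊆A , ∋s) → N⊆A β (Contains⇒ v s ∋s))
    where
    W : Pred (ℕ → ℕ) 0ℓ
    W α = ∃[ s ] (∀ γ → γ ∈ N 𝒩 s → γ ∈ A) × Contains n s α
  pullback {ξ} {A} n (union 2≤ξ P Π-P (A⊆ , A⊇)) =
    ⋃ ℕ (λ m → proj₁ (pull m)) ,
    union 2≤ξ (λ m → proj₁ (pull m))
      (λ m → let ζ , 1≤ζ , ζ<ξ , _ = Π-P m in ζ , 1≤ζ , ζ<ξ , proj₁ (proj₂ (pull m)))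
      ((λ x → x) , (λ x → x)) ,
    λ α β v →
      (λ β∈A → let m , β∈P = A⊆ β∈A in m , proj₁ (proj₂ (proj₂ (pull m)) α β v) β∈P) ,
      (λ (m , α∈W) → A⊇ (m , proj₂ (proj₂ (proj₂ (pull m)) α β v) α∈W))
    where
    pull : ∀ m → Σ[ W ∈ Pred (ℕ → ℕ) 0ℓ ] Π⁰ 𝒩 (proj₁ (Π-P m)) W × Represents n W (P m)
    pull m = pullbackΠ n (proj₂ (proj₂ (proj₂ (Π-P m))))

  pullbackΠ n (complement B Σ-B (A⊆ , A⊇)) =
    let W , Σ-W , represents = pullback n Σ-B
    in ∁ W , ∁-Π Σ-W , λ α β v →
         (λ β∈A α∈W → A⊆ β∈A (proj₂ (represents α β v) α∈W)) ,
         (λ α∉W → A⊇ λ β∈B → α∉W (proj₁ (represents α β v) β∈B))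

  Meet : ℕ → ℕ → Set
  Meet s t = ∃[ γ ] γ ∈ N 𝒩 s × γ ∈ N 𝒩 t

  -- {α *}(n) is defined iff the codes listed by α * for n form a filter of basic open
  -- sets that contains arbitrarily small ones; this is visibly a Borel condition on α.
  Small Consistent UpwardClosed : ℕ → Pred (ℕ → ℕ) 0ℓ
  Small        n α = ∀ k → ∃[ s ] Contains n (cylinder s k) α
  Consistent   n α = ∀ s t → ¬ Meet s t → ¬ (Contains n s α × Contains n t α)
  UpwardClosed n α = ∀ s t → (∀ γ → γ ∈ N 𝒩 s → γ ∈ N 𝒩 t) → Contains n s α → Contains n t α

  -- Coordinate `i` of the value is the last one fixed by the chosen cylinder of level `i`.
  -- Consistency makes the chosen cylinders cohere, and upward closure then puts every basic
  -- neighbourhood of the value on the list.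
  filter⇒Value : ∀ {n α} → Small n α → Consistent n α → UpwardClosed n α → ∃ (Value n α)
  filter⇒Value {n} {α} small consistent upward = β , mkValue ⇒ ⇐
    where
    centre : ℕ → ℕ
    centre k = proj₁ (small k)

    ∋cylinder : ∀ k → Contains n (cylinder (centre k) k) α
    ∋cylinder k = proj₂ (small k)

    meet : ∀ s t → Contains n s α → Contains n t α → Meet s t
    meet s t ∋s ∋t = stable λ ¬meet → consistent s t ¬meet (∋s , ∋t)

    β : ℕ → ℕ
    β i = ⦅ centre i ⦆ i

    agree : ∀ k → Agree (suc k) β (⦅ centre k ⦆_)
    agree k i i<1+k =
      let γ , γ∈i , γ∈k = meet (cylinder (centre i) i) (cylinder (centre k) k)
            (∋cylinder i) (∋cylinder k)
      in trans (sym (∈cylinder⇒agree (centre i) i γ∈i i ℕₚ.≤-refl))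
               (∈cylinder⇒agree (centre k) k γ∈k i i<1+k)

    near : ∀ {γ} k → γ ∈ N 𝒩 (cylinder (centre k) k) → Agree k β γ
    near {γ} k γ∈ i i<k = trans (agree k i (ℕₚ.m<n⇒m<1+n i<k))
      (sym (∈cylinder⇒agree (centre k) k γ∈ i (ℕₚ.m<n⇒m<1+n i<k)))

    ⇒ : ∀ t → β ∈ N 𝒩 t → Contains n t α
    ⇒ t β∈N = let k , determined = N-determined t in
      upward (cylinder (centre k) k) t (λ γ γ∈ → determined γ β (agree-sym {k} {β} {γ} (near k γ∈)) β∈N)
        (∋cylinder k)

    ⇐ : ∀ t → Contains n t α → β ∈ N 𝒩 t
    ⇐ t ∋t = let k , determined = N-determined t
                 γ , γ∈ , γ∈N = meet (cylinder (centre k) k) t (∋cylinder k) ∋t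
             in determined β γ (near k γ∈) γ∈N

  Value⇒filter : ∀ {n α β} → Value n α β → Small n α × Consistent n α × UpwardClosed n α
  Value⇒filter {n} {α} {β} v =
    (λ k → let s = prefixCode (suc k) β in
       s , ⇒Contains v (cylinder s k)
             (agree⇒∈cylinder s k (agree-sym {suc k} {⦅ s ⦆_} {β} (prefixCode-agree (suc k) β)))) ,
    (λ s t ¬meet (∋s , ∋t) → ¬meet (β , Contains⇒ v s ∋s , Contains⇒ v t ∋t)) ,
    (λ s t s⊆t ∋s → ⇒Contains v t (s⊆t β (Contains⇒ v s ∋s)))

  Contains-Borel : ∀ n s → Borel (Contains n s)
  Contains-Borel n s = oneₒ , open⇒Σ (≤ₒ-refl oneₒ) (Contains-local n s)

  defined-Borel : ∀ n → Borel (λ α → ∃ (Value n α))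
  defined-Borel n = Borel-≐
    ( (λ (small , consistent , upward) → filter⇒Value small consistent upward)
    , (λ (_ , v) → Value⇒filter v))
    (Borel-∩ (Borel-⋂ λ k → Borel-⋃ λ s → Contains-Borel n (cylinder s k))
    (Borel-∩ (Borel-⋂ λ s → Borel-⋂ λ t → Borel-⇒ (Borel-const _)
                (Borel-∁ (Borel-∩ (Contains-Borel n s) (Contains-Borel n t))))
             (Borel-⋂ λ s → Borel-⋂ λ t → Borel-⇒ (Borel-const _)
                (Borel-⇒ (Contains-Borel n s) (Contains-Borel n t)))))

  value-Borel : ∀ n → Borel A → Borel (λ α → ∃[ β ] Value n α β × A β)
  value-Borel n (ξ , Σ-A) with pullback n Σ-A
  ... | W , Σ-W , represents = Borel-≐
    ( (λ {α} ((β , v) , α∈W) → β , v , proj₂ (represents α β v) α∈W)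
    , (λ {α} (β , v , β∈A) → (β , v) , proj₁ (represents α β v) β∈A))
    -- `W` is correct only where the value exists, so the domain is added as a condition.
    (Borel-∩ (defined-Borel n) (ξ , Σ-W))

  -- The sets of Borel codes are Borel

  1≤∧≈0⇒⊥ : oneₒ ≤ₒ ξ → ξ ≈ₒ zeroₒ → ⊥
  1≤∧≈0⇒⊥ {ξ} 1≤ξ (ξ≤0 , _) = ≤ₒ-trans {oneₒ} {ξ} {zeroₒ} 1≤ξ ξ≤0

  BC-resp-≈ₒ : ∀ {α} → ζ ≈ₒ ξ → BC ζ α → BC ξ α
  BC-resp-≈ₒ {ζ} {ξ} ζ≈ξ (base ζ≈0 α0≡0) =
    base (≈ₒ-trans {ξ} {ζ} {zeroₒ} (≈ₒ-sym {ζ} {ξ} ζ≈ξ) ζ≈0) α0≡0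
  BC-resp-≈ₒ {ζ} {ξ} (ζ≤ξ , _) (step 1≤ζ α0≡1 values) =
    step (≤ₒ-trans {oneₒ} {ζ} {ξ} 1≤ζ ζ≤ξ) α0≡1 λ n →
      let η , η<ζ , rest = values n in η , <-≤ₒ-trans {η} {ζ} {ξ} η<ζ ζ≤ξ , rest

  BC-resp-≗ : ∀ {α α′} → α ≗ α′ → BC ξ α → BC ξ α′
  BC-resp-≗ α≗α′ (base ξ≈0 α0≡0) = base ξ≈0 (trans (sym (α≗α′ 0)) α0≡0)
  BC-resp-≗ {α = α} {α′} α≗α′ (step 1≤ξ α0≡1 values) = step 1≤ξ (trans (sym (α≗α′ 0)) α0≡1) λ n →
    let ζ , ζ<ξ , β , ↓β , β∈BC = values n
    in ζ , ζ<ξ , β , Value⇒↓ n α′ β (Value-resp-≗ α≗α′ (↓⇒Value n α β ↓β)) , β∈BC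

  -- `BC ξ` for positive `ξ`, with the quantifier over ordinals below `ξ` turned into one over
  -- natural numbers, as a countable union requires.
  Step : Ord → Pred (ℕ → ℕ) 0ℓ
  Step ξ α = α 0 ≡ 1 × (∀ n → ∃[ k ] ∃[ β ] Value n α β × BC (below ξ k) β)

  Step⇒BC : ∀ ξ α → oneₒ ≤ₒ ξ → Step ξ α → BC ξ α
  Step⇒BC ξ α 1≤ξ (α0≡1 , values) = step 1≤ξ α0≡1 λ n →
    let k , β , v , β∈BC = values n
    in below ξ k , below-< {ξ} 1≤ξ k , β , Value⇒↓ n α β v , β∈BC

  BC⇒Step : ∀ ξ α → oneₒ ≤ₒ ξ → BC ξ α → Step ξ α
  BC⇒Step ξ α 1≤ξ (base ξ≈0 _)           = ⊥-elim (1≤∧≈0⇒⊥ {ξ} 1≤ξ ξ≈0)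
  BC⇒Step ξ α 1≤ξ (step _ α0≡1 values) = α0≡1 , λ n →
    let ζ , ζ<ξ , β , ↓β , β∈BC = values n
        k , ζ≈ = below-surjective {ξ} {ζ} ζ<ξ
    in k , β , ↓⇒Value n α β ↓β , BC-resp-≈ₒ {ζ} {below ξ k} {β} ζ≈ β∈BC

  BC₀⇒ : ∀ ξ α → ξ ≈ₒ zeroₒ → BC ξ α → α 0 ≡ 0
  BC₀⇒ ξ α ξ≈0 (base _ α0≡0)  = α0≡0
  BC₀⇒ ξ α ξ≈0 (step 1≤ξ _ _) = ⊥-elim (1≤∧≈0⇒⊥ {ξ} 1≤ξ ξ≈0)

  head-Borel : ∀ j → Borel (λ α → α 0 ≡ j)
  head-Borel j = oneₒ , Σ-coordinates {oneₒ} (≤ₒ-refl oneₒ) 1 (λ α → α 0 ≡ j)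
    λ β γ agree β0≡j → trans (sym (agree 0 ℕₚ.≤-refl)) β0≡j

  BC-Borel : ∀ ξ → Borel (BC ξ)
  BC-Borel ξ = go ξ (<ₒ-wellFounded ξ)
    where
    go : ∀ ξ → Acc _<ₒ_ ξ → Borel (BC ξ)
    go ξ (acc rs) with 0or1≤ ξ
    ... | inj₁ ξ≈0 = Borel-≐ {λ α → α 0 ≡ 0} {BC ξ} (base ξ≈0 , λ {α} → BC₀⇒ ξ α ξ≈0) (head-Borel 0)
    ... | inj₂ 1≤ξ = Borel-≐ {Step ξ} {BC ξ} ((λ {α} → Step⇒BC ξ α 1≤ξ) , λ {α} → BC⇒Step ξ α 1≤ξ)
      (Borel-∩ (head-Borel 1)
        (Borel-⋂ λ n → Borel-⋃ λ k → value-Borel n (go (below ξ k) (rs (below-< {ξ} 1≤ξ k)))))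

  -- The functions `rbc` and `apb` satisfy their defining conditions

  rbc-isLeast : ∀ ξ → IsLeast (λ η → oneₒ ≤ₒ η × Π⁰ 𝒩 η (BC ξ)) (rbc em ξ)
  rbc-isLeast ξ = let η , Π-BC = Borel⇒Π (BC-Borel ξ) in least-isLeast (η , Π⇒1≤ Π-BC , Π-BC)

  rbc-resp-≈ₒ : ζ ≈ₒ ξ → rbc em ζ ≤ₒ rbc em ξ
  rbc-resp-≈ₒ {ζ} {ξ} ζ≈ξ = let (1≤rbc , Π-BC) , _ = rbc-isLeast ξ in
    proj₂ (rbc-isLeast ζ) (rbc em ξ) (1≤rbc , Π-≐ {BC ξ} {BC ζ} {rbc em ξ}
      ( (λ {α} → BC-resp-≈ₒ {ξ} {ζ} {α} (≈ₒ-sym {ζ} {ξ} ζ≈ξ))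
      , (λ {α} → BC-resp-≈ₒ {ζ} {ξ} {α} ζ≈ξ)) Π-BC)

  apbTerms : ∀ ξ → (∀ {η} → η <ₒ ξ → Acc _<ₒ_ η) → Pred Ord 0ℓ
  apbTerms ξ rs ζ = ∃[ η ] Σ[ η<ξ ∈ η <ₒ ξ ] oneₒ ≤ₒ η ×
    ζ ≡ max em (apbAcc em η (rs η<ξ)) (sucₒ (rbc em η))

  -- The terms at the ordinals `below ξ k` are countably many and have a strict upper bound. Every
  -- other term is transferred to one of these along `≈ₒ`, which is why boundedness and invariance
  -- are proved together.
  apbTerms-bounded : ∀ ξ (rs : ∀ {η} → η <ₒ ξ → Acc _<ₒ_ η) → Bounded (apbTerms ξ rs)
  -- With `ζ` and `ξ` the same tree, this is independence of the accessibility proof.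
  apbAcc-resp-≈ₒ : ∀ ζ ξ (a : Acc _<ₒ_ ζ) (a′ : Acc _<ₒ_ ξ) → ζ ≈ₒ ξ →
    apbAcc em ζ a ≤ₒ apbAcc em ξ a′

  apbTerms-bounded ξ rs with 0or1≤ ξ
  ... | inj₁ ξ≈0 = zeroₒ , λ ζ (η , η<ξ , _) → ⊥-elim (1≤∧≈0⇒⊥ (<ₒ⇒1≤ {η} {ξ} η<ξ) ξ≈0)
  ... | inj₂ 1≤ξ = lsub bound , λ where
      _ (η , η<ξ , 1≤η , refl) →
        let k , η≈ = below-surjective {ξ} {η} η<ξ in
        <⇒≤ₒ {max em (apbAcc em η (rs η<ξ)) (sucₒ (rbc em η))} {lsub bound}
          (k , max-mono (apbAcc-resp-≈ₒ η (below ξ k) (rs η<ξ) (rs (below-< {ξ} 1≤ξ k)) η≈)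
                 (sucₒ-mono {rbc em η} (rbc-resp-≈ₒ {η} {below ξ k} η≈)))
    where
    bound : ℕ → Ord
    bound k = max em (apbAcc em (below ξ k) (rs (below-< {ξ} 1≤ξ k))) (sucₒ (rbc em (below ξ k)))

  apbAcc-resp-≈ₒ ζ ξ (acc rs) (acc rs′) ζ≈ξ with em {P = ζ ≈ₒ oneₒ} | em {P = ξ ≈ₒ oneₒ}
  ... | yes _   | yes _   = ≤ₒ-refl oneₒ
  ... | yes ζ≈1 | no  ξ≉1 = ⊥-elim (ξ≉1 (≈ₒ-trans {ξ} {ζ} {oneₒ} (≈ₒ-sym {ζ} {ξ} ζ≈ξ) ζ≈1))
  ... | no  ζ≉1 | yes ξ≈1 = ⊥-elim (ζ≉1 (≈ₒ-trans {ζ} {ξ} {oneₒ} ζ≈ξ ξ≈1))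
  ... | no  _   | no  _   = sucₒ-mono {sup em (apbTerms ζ rs)}
    (sup-mono (apbTerms-bounded ξ rs′) λ where
      _ (η , η<ζ , 1≤η , refl) →
        let η<ξ = <-≤ₒ-trans {η} {ζ} {ξ} η<ζ (proj₁ ζ≈ξ) in
        _ , (η , η<ξ , 1≤η , refl) ,
        max-mono (apbAcc-resp-≈ₒ η η (rs η<ζ) (rs′ η<ξ) (≈ₒ-refl {η})) (≤ₒ-refl (sucₒ (rbc em η))))

  apbAcc-step : ∀ η ξ (a : Acc _<ₒ_ η) (a′ : Acc _<ₒ_ ξ) → oneₒ ≤ₒ η → η <ₒ ξ →
    max em (apbAcc em η a) (sucₒ (rbc em η)) <ₒ apbAcc em ξ a′
  apbAcc-step η ξ a (acc rs) 1≤η η<ξ with em {P = ξ ≈ₒ oneₒ}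
  ... | yes ξ≈1 = ⊥-elim (2≤∧≈1⇒⊥ (1≤⇒2≤ {η} {ξ} 1≤η η<ξ) ξ≈1)
  ... | no  _   = 0 , ≤ₒ-trans {max em (apbAcc em η a) (sucₒ (rbc em η))}
      {max em (apbAcc em η (rs η<ξ)) (sucₒ (rbc em η))}
    (max-mono (apbAcc-resp-≈ₒ η η a (rs η<ξ) (≈ₒ-refl {η})) (≤ₒ-refl (sucₒ (rbc em η))))
    (sup-upper (apbTerms-bounded ξ rs) _ (η , η<ξ , 1≤η , refl))

  1≤apbAcc : ∀ ξ (a : Acc _<ₒ_ ξ) → oneₒ ≤ₒ apbAcc em ξ a
  1≤apbAcc ξ (acc rs) with em {P = ξ ≈ₒ oneₒ}
  ... | yes _ = ≤ₒ-refl oneₒ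
  ... | no  _ = λ _ → 0 , tt

  1≤apb : ∀ ξ → oneₒ ≤ₒ apb em ξ
  1≤apb ξ = 1≤apbAcc ξ (<ₒ-wellFounded ξ)

  apb-< : ∀ {η ξ} → oneₒ ≤ₒ η → η <ₒ ξ → apb em η <ₒ apb em ξ
  apb-< {η} {ξ} 1≤η η<ξ = ≤-<ₒ-trans {apb em η} {max em (apb em η) (sucₒ (rbc em η))} {apb em ξ}
    (≤-maxˡ (apb em η) (sucₒ (rbc em η)))
      (apbAcc-step η ξ (<ₒ-wellFounded η) (<ₒ-wellFounded ξ) 1≤η η<ξ)

  rbc<apb : ∀ {η ξ} → oneₒ ≤ₒ η → η <ₒ ξ → rbc em η <ₒ apb em ξ
  rbc<apb {η} {ξ} 1≤η η<ξ = ≤-<ₒ-trans {rbc em η} {max em (apb em η) (sucₒ (rbc em η))} {apb em ξ}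
    (≤ₒ-trans {rbc em η} {sucₒ (rbc em η)} {max em (apb em η) (sucₒ (rbc em η))}
      (<⇒≤ₒ {rbc em η} (<ₒ-sucₒ (rbc em η))) (≤-maxʳ (apb em η) (sucₒ (rbc em η))))
    (apbAcc-step η ξ (<ₒ-wellFounded η) (<ₒ-wellFounded ξ) 1≤η η<ξ)

  -- The function c, given by the disjointness relation of the basic open sets

  module OpenCode (disjoint : ℕ → ℕ → Bool) where

    false≢true : false ≢ true
    false≢true ()

    Avoids : ℕ → (ℕ → ℕ) → Set
    Avoids s γ = ∀ m → disjoint s (γ m) ≡ true

    -- An open code has to list a basic set at every index, so an `s` that meets the open set coded
    -- by `γ` is replaced by the empty ball.
    exteriorEntry : ℕ → (ℕ → ℕ) → ℕ
    exteriorEntry s γ = if does (em {P = Avoids s γ}) then s else emptyCode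

    exteriorEntry-avoids : ∀ s γ → Avoids s γ → exteriorEntry s γ ≡ s
    exteriorEntry-avoids s γ avoids with em {P = Avoids s γ}
    ... | yes _       = refl
    ... | no  ¬avoids = ⊥-elim (¬avoids avoids)

    exteriorEntry-meets : ∀ s γ → ¬ Avoids s γ → exteriorEntry s γ ≡ emptyCode
    exteriorEntry-meets s γ ¬avoids with em {P = Avoids s γ}
    ... | yes avoids = ⊥-elim (¬avoids avoids)
    ... | no  _      = refl

    exteriorEntry-cong : ∀ s {γ γ′} → γ ≗ γ′ → exteriorEntry s γ ≡ exteriorEntry s γ′
    exteriorEntry-cong s {γ} {γ′} γ≗γ′ with em {P = Avoids s γ}
    ... | yes avoids  = sym (exteriorEntry-avoids s γ′ λ m → trans
        (cong (disjoint s) (sym (γ≗γ′ m))) (avoids m))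
    ... | no  ¬avoids = sym (exteriorEntry-meets s γ′ λ avoids → ¬avoids λ m →
                          trans (cong (disjoint s) (γ≗γ′ m)) (avoids m))

    -- The s-th basic open set to be put into an open set that approximates the complement of
    -- π β, where γ is an open code that approximates π β if β has positive rank.
    complementEntry : (β γ : ℕ → ℕ) → ℕ → ℕ
    complementEntry β γ s with β 0
    ... | zero  = β 1
    ... | suc _ = exteriorEntry s γ

    complementEntry-0 : ∀ β γ s → β 0 ≡ 0 → complementEntry β γ s ≡ β 1
    complementEntry-0 β γ s β0≡0 rewrite β0≡0 = refl

    complementEntry-1 : ∀ β γ s → β 0 ≡ 1 → complementEntry β γ s ≡ exteriorEntry s γ
    complementEntry-1 β γ s β0≡1 rewrite β0≡1 = refl

    complementEntry-cong : ∀ {β β′ γ γ′} s → β ≗ β′ → γ ≗ γ′ →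
      complementEntry β γ s ≡ complementEntry β′ γ′ s
    complementEntry-cong {β} {β′} s β≗β′ γ≗γ′ rewrite sym (β≗β′ 0) with β 0
    ... | zero  = β≗β′ 1
    ... | suc _ = exteriorEntry-cong s γ≗γ′

    Child : Ord → (ℕ → ℕ) → ℕ → Set
    Child ξ α n = ∃[ ζ ] ζ <ₒ ξ × ∃[ β ] ⟪ α * ⟫ n ↓ β × BC ζ β

    openCode : ∀ {ξ α} → BC ξ α → ℕ → ℕ
    childEntry : ∀ ξ α n → Child ξ α n → ℕ → ℕ

    -- A dummy value: for a child `β` of rank 0, `complementEntry` returns `β 1`.
    openCode         (base _ _)        k = 0
    openCode {ξ} {α} (step _ _ values) k = childEntry ξ α (⦅ k ⦆ 0) (values (⦅ k ⦆ 0)) (⦅ k ⦆ 1)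

    childEntry ξ α n (ζ , _ , β , _ , β∈BC) s = complementEntry β (openCode β∈BC) s

    -- Two derivations may carry different ranks and different representatives of the children, but
    -- the children are unique up to `≗`. This yields extensionality of the code function and its
    -- coherence across all ranks at once.
    openCode-cong : ∀ {ξ ξ′ α α′} (b : BC ξ α) (b′ : BC ξ′ α′) → α ≗ α′ → openCode b ≗ openCode b′
    childEntry-cong : ∀ ξ ξ′ α α′ n (v : Child ξ α n) (v′ : Child ξ′ α′ n) → α ≗ α′ →
      ∀ s → childEntry ξ α n v s ≡ childEntry ξ′ α′ n v′ s

    openCode-cong (base _ _)        (base _ _)         α≗α′ k = refl
    openCode-cong (base _ α0≡0)   (step _ α′0≡1 _) α≗α′ k =
      ⊥-elim (ℕₚ.0≢1+n (trans (sym α0≡0) (trans (α≗α′ 0) α′0≡1)))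
    openCode-cong (step _ α0≡1 _) (base _ α′0≡0)   α≗α′ k =
      ⊥-elim (ℕₚ.1+n≢0 (trans (sym α0≡1) (trans (α≗α′ 0) α′0≡0)))
    openCode-cong {ξ} {ξ′} {α} {α′} (step _ _ values) (step _ _ values′) α≗α′ k =
      childEntry-cong ξ ξ′ α α′ (⦅ k ⦆ 0) (values (⦅ k ⦆ 0)) (values′ (⦅ k ⦆ 0)) α≗α′ (⦅ k ⦆ 1)

    childEntry-cong ξ ξ′ α α′ n (_ , _ , β , ↓β , b) (_ , _ , β′ , ↓β′ , b′) α≗α′ s =
      complementEntry-cong s β≗β′ (openCode-cong b b′ β≗β′)
      where
      β≗β′ : β ≗ β′
      β≗β′ = Value-unique α≗α′ (↓⇒Value n α β ↓β) (↓⇒Value n α′ β′ ↓β′)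

    -- Measurability of the code function

    EntryMeasurable : Ord → Set₁
    EntryMeasurable ξ = ∀ k j → Σ[ W ∈ Pred (ℕ → ℕ) 0ℓ ] Σ⁰ 𝒩 (apb em ξ) W ×
      (∀ α (b : BC ξ α) → (openCode b k ≡ j → W α) × (W α → openCode b k ≡ j))

    -- `K` itself demands `BC η`, since all ranks below `ξ` will be tried on the same child. For `η`
    -- zero the condition is open, as it must be when `apb ξ` is 1. For positive `η`, `rbc η` and
    -- `apb η` are strictly below `apb ξ`, which leaves room for the `Π⁰` conditions.
    complementEntry-measurable : ∀ η ξ → η <ₒ ξ → (oneₒ ≤ₒ η → EntryMeasurable η) →
      ∀ s j → Σ[ K ∈ Pred (ℕ → ℕ) 0ℓ ] Σ⁰ 𝒩 (apb em ξ) K × (∀ β →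
        (K β → Σ[ b ∈ BC η β ] complementEntry β (openCode b) s ≡ j) ×
        ((b : BC η β) → complementEntry β (openCode b) s ≡ j → K β))
    complementEntry-measurable η ξ η<ξ measurable s j with 0or1≤ η
    ... | inj₁ η≈0 = K , Σ-coordinates (1≤apb ξ) 2 K K-resp , λ β →
        (λ (β0≡0 , β1≡j) → base η≈0 β0≡0 , trans (complementEntry-0 β _ s β0≡0) β1≡j) ,
        (λ b eq → let β0≡0 = BC₀⇒ η β η≈0 b in
           β0≡0 , trans (sym (complementEntry-0 β (openCode b) s β0≡0)) eq)
      where
      K : Pred (ℕ → ℕ) 0ℓ
      K β = β 0 ≡ 0 × β 1 ≡ j

      K-resp : ∀ β γ → Agree 2 β γ → K β → K γ
      K-resp β γ agree (β0≡0 , β1≡j) =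
        trans (sym (agree 0 (ℕ.s≤s ℕ.z≤n))) β0≡0 , trans (sym (agree 1 ℕₚ.≤-refl)) β1≡j
    ... | inj₂ 1≤η = K , Σ-K , λ β →
        (λ (b , cases) → b , trans (complementEntry-1 β (openCode b) s (head β b))
            (from β b cases)) ,
        (λ b eq → b , to β b (trans (sym (complementEntry-1 β (openCode b) s (head β b))) eq))
      where
      W : ℕ → ℕ → Pred (ℕ → ℕ) 0ℓ
      W m t = proj₁ (measurable 1≤η m t)

      -- The failure of `Avoids`, with the entries of the code replaced by the sets `W m t`. This
      -- makes sense on all of `𝒩`, whereas the code exists only on `BC η`.
      Meets : Pred (ℕ → ℕ) 0ℓ
      Meets β = ∃[ m ] ∃[ t ] disjoint s t ≡ false × W m t β

      K : Pred (ℕ → ℕ) 0ℓ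
      K β = BC η β × (s ≡ j × ¬ Meets β ⊎ emptyCode ≡ j × Meets β)

      Σ-Meets : Σ⁰ 𝒩 (apb em η) Meets
      Σ-Meets = Σ-⋃ λ m → Σ-⋃ λ t →
        Σ-∩ (Σ-const (1≤apb η) (disjoint s t ≡ false)) (proj₁ (proj₂ (measurable 1≤η m t)))

      apbη<apbξ : apb em η <ₒ apb em ξ
      apbη<apbξ = apb-< {η} {ξ} 1≤η η<ξ

      Σ-K : Σ⁰ 𝒩 (apb em ξ) K
      Σ-K = Σ-∩ (Π⇒Σ {rbc em η} {apb em ξ} (rbc<apb {η} {ξ} 1≤η η<ξ)
        (proj₂ (proj₁ (rbc-isLeast η))))
        (Σ-∪ (Σ-∩ (Σ-const (1≤apb ξ) (s ≡ j)) (Π⇒Σ {apb em η} {apb em ξ} apbη<apbξ (∁-Π Σ-Meets)))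
             (Σ-∩ (Σ-const (1≤apb ξ) (emptyCode ≡ j))
                  (Σ-mono {apb em η} {apb em ξ} (<⇒≤ₒ {apb em η} {apb em ξ} apbη<apbξ) Σ-Meets)))

      head : ∀ β → BC η β → β 0 ≡ 1
      head β b = proj₁ (BC⇒Step η β 1≤η b)

      Meets⇒¬Avoids : ∀ β (b : BC η β) → Meets β → ¬ Avoids s (openCode b)
      Meets⇒¬Avoids β b (m , t , disjoint≡false , β∈W) avoids = false≢true
        (trans (sym disjoint≡false)
          (trans (cong (disjoint s) (sym (proj₂ (proj₂ (proj₂ (measurable 1≤η m t)) β b) β∈W)))
            (avoids m)))

      ¬Meets⇒Avoids : ∀ β (b : BC η β) → ¬ Meets β → Avoids s (openCode b)
      ¬Meets⇒Avoids β b ¬meets m with disjoint s (openCode b m) in eq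
      ... | true  = refl
      ... | false = ⊥-elim (¬meets (m , openCode b m , eq ,
                      proj₁ (proj₂ (proj₂ (measurable 1≤η m (openCode b m))) β b) refl))

      from : ∀ β (b : BC η β) → s ≡ j × ¬ Meets β ⊎ emptyCode ≡ j × Meets β →
        exteriorEntry s (openCode b) ≡ j
      from β b (inj₁ (s≡j , ¬meets)) =
        trans (exteriorEntry-avoids s (openCode b) (¬Meets⇒Avoids β b ¬meets)) s≡j
      from β b (inj₂ (∅≡j , meets)) =
        trans (exteriorEntry-meets s (openCode b) (Meets⇒¬Avoids β b meets)) ∅≡j

      to : ∀ β (b : BC η β) → exteriorEntry s (openCode b) ≡ j →
        s ≡ j × ¬ Meets β ⊎ emptyCode ≡ j × Meets β
      to β b eq with em {P = Meets β}
      ... | yes meets = inj₂ (trans (sym (exteriorEntry-meets s (openCode b) (Meets⇒¬Avoids β b meets)))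
          eq , meets)
      ... | no ¬meets = inj₁ (trans (sym (exteriorEntry-avoids s (openCode b) (¬Meets⇒Avoids β b ¬meets)))
          eq , ¬meets)

    -- The union over `i` tries every rank below `ξ` for the child. Whichever rank succeeds gives
    -- the right entry, because `openCode` is the same for all derivations.
    entryMeasurable : ∀ ξ → Acc _<ₒ_ ξ → oneₒ ≤ₒ ξ → EntryMeasurable ξ
    entryMeasurable ξ (acc rs) 1≤ξ k j = proj₁ W , proj₁ (proj₂ W) , λ α b → correct α b
      where
      n s : ℕ
      n = ⦅ k ⦆ 0
      s = ⦅ k ⦆ 1

      K : ∀ i → Σ[ K ∈ Pred (ℕ → ℕ) 0ℓ ] Σ⁰ 𝒩 (apb em ξ) K × (∀ β →
        (K β → Σ[ b ∈ BC (below ξ i) β ] complementEntry β (openCode b) s ≡ j) ×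
        ((b : BC (below ξ i) β) → complementEntry β (openCode b) s ≡ j → K β))
      K i = complementEntry-measurable (below ξ i) ξ (below-< {ξ} 1≤ξ i)
        (entryMeasurable (below ξ i) (rs (below-< {ξ} 1≤ξ i))) s j

      W : Σ[ W ∈ Pred (ℕ → ℕ) 0ℓ ] Σ⁰ 𝒩 (apb em ξ) W × Represents n W (⋃ ℕ (λ i → proj₁ (K i)))
      W = pullback n (Σ-⋃ {P = λ i → proj₁ (K i)} λ i → proj₁ (proj₂ (K i)))

      to : ∀ α (v : Child ξ α n) → childEntry ξ α n v s ≡ j → proj₁ W α
      to α (ζ , ζ<ξ , β , ↓β , b) eq =
        let i , ζ≈ = below-surjective {ξ} {ζ} ζ<ξ
            b′ = BC-resp-≈ₒ {ζ} {below ξ i} {β} ζ≈ b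
        in proj₁ (proj₂ (proj₂ W) α β (↓⇒Value n α β ↓β))
             (i , proj₂ (proj₂ (proj₂ (K i)) β) b′
               (trans (complementEntry-cong {β} s (λ _ → refl)
                 (openCode-cong b′ b (λ _ → refl))) eq))

      from : ∀ α (v : Child ξ α n) → proj₁ W α → childEntry ξ α n v s ≡ j
      from α (ζ , ζ<ξ , β , ↓β , b) α∈W =
        let i , β∈K = proj₂ (proj₂ (proj₂ W) α β (↓⇒Value n α β ↓β)) α∈W
            b′ , eq = proj₁ (proj₂ (proj₂ (K i)) β) β∈K
        in trans (complementEntry-cong {β} s (λ _ → refl) (openCode-cong b b′ (λ _ → refl))) eq

      correct : ∀ α (b : BC ξ α) → (openCode b k ≡ j → proj₁ W α) × (proj₁ W α → openCode b k ≡ j)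
      correct α (base ξ≈0 _)      = ⊥-elim (1≤∧≈0⇒⊥ {ξ} 1≤ξ ξ≈0)
      correct α (step _ _ values) = to α (values n) , from α (values n)

    openCodeFunc : ∀ ξ → Func (Subspace 𝒩 (BC ξ)) (Presentation.setoid 𝒩)
    openCodeFunc ξ = record
      { to   = λ (_ , b) → openCode b
      ; cong = λ {(_ , b)} {(_ , b′)} → openCode-cong b b′
      }

    -- `V` is a countable union of cylinders, and the preimage of a cylinder is a finite
    -- intersection of conditions on entries.
    openCode-measurable : ∀ ξ → oneₒ ≤ₒ ξ → Measurable 𝒩 𝒩 (Σ⁰ 𝒩 (apb em ξ)) (openCodeFunc ξ)
    openCode-measurable ξ 1≤ξ V open-V = W , Σ-W , (λ {x} → to {x}) , λ {x} → from {x}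
      where
      E : EntryMeasurable ξ
      E = entryMeasurable ξ (<ₒ-wellFounded ξ) 1≤ξ

      W : Pred (ℕ → ℕ) 0ℓ
      W α = ∃[ s ] ∃[ k ] (∀ γ → Agree k γ (⦅ s ⦆_) → γ ∈ V) ×
        (∀ i → i ℕ.< k → proj₁ (E i (⦅ s ⦆ i)) α)

      Σ-W : Σ⁰ 𝒩 (apb em ξ) W
      Σ-W = Σ-⋃ λ s → Σ-⋃ λ k → Σ-∩ (Σ-const (1≤apb ξ) _)
        (Σ-⋂< {apb em ξ} {λ i → proj₁ (E i (⦅ s ⦆ i))} k (1≤apb ξ)
          λ i → proj₁ (proj₂ (E i (⦅ s ⦆ i))))

      to : ∀ {(α , b) : ∃ (BC ξ)} → openCode b ∈ V → W α
      to {α , b} ∈V =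
        let k , nbhd = IsOpen⇒Local open-V (openCode b) ∈V
            s = prefixCode k (openCode b)
            s-agree = prefixCode-agree k (openCode b)
        in s , k , (λ γ agree → nbhd γ λ i i<k → sym (trans (agree i i<k) (s-agree i i<k))) ,
           λ i i<k → proj₁ (proj₂ (proj₂ (E i (⦅ s ⦆ i))) α b) (sym (s-agree i i<k))

      from : ∀ {(α , b) : ∃ (BC ξ)} → W α → openCode b ∈ V
      from {α , b} (s , k , ⊆V , α∈W) = ⊆V (openCode b) λ i i<k →
        proj₂ (proj₂ (proj₂ (E i (⦅ s ⦆ i))) α b) (α∈W i i<k)

  -- Basic open sets and meager sets of a Polish space

  module Approximation {c ℓ} (X : Presentation c ℓ) (X-isPolish : IsPolish X) where

    open Presentation X
    open IsPolish X-isPolish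
    open Metric.IsGeneralMetric isMetric using (nonNegative; ≈⇒0; triangle) renaming (sym to d-sym)

    Ball-sym : ∀ x y ε → y ∈ Ball d x ε → x ∈ Ball d y ε
    Ball-sym x y ε = ≤-<ᵣ-trans (d y x) (d x y) ε (proj₁ (d-sym y x))

    Ball-triangle : ∀ x y z a b → y ∈ Ball d x a → z ∈ Ball d y b → z ∈ Ball d x (a ℚ.+ b)
    Ball-triangle x y z a b y∈ z∈ = ≤-<ᵣ-trans (d x z) (d x y +ᵣ d y z) (a ℚ.+ b) (triangle x y z)
      (+ᵣ-mono-< (d x y) (d y z) a b y∈ z∈)

    centre∈Ball : ∀ x ε → 0ℚ ℚ.< ε → x ∈ Ball d x ε
    centre∈Ball x ε 0<ε = ≤-<ᵣ-trans (d x x) 0ᵣ ε (proj₁ (≈⇒0 (Setoid.refl setoid)))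
      (let δ , 0<δ , <ε = <⇒gap 0<ε in δ , 0<δ , 0 , λ _ _ → <ε)

    Ball-open : ∀ x ε y → y ∈ Ball d x ε → ∃[ δ ] 0ℚ ℚ.< δ × (∀ z → z ∈ Ball d y δ → z ∈ Ball d x ε)
    Ball-open x ε y y∈ = let δ , 0<δ , y∈′ = <ᵣ-gap (d x y) ε y∈ in
      δ , 0<δ , λ z z∈ → subst (λ e → z ∈ Ball d x e) (ℚ-group.//-rightDividesˡ δ ε)
        (Ball-triangle x y z (ε ℚ.- δ) δ y∈′ z∈)

    N-open : ∀ s y → y ∈ N X s → ∃[ δ ] 0ℚ ℚ.< δ × (∀ z → z ∈ Ball d y δ → z ∈ N X s)
    N-open s y y∈N =
      let centre = r (⦅ s ⦆ 0)
          q = radius (⦅ s ⦆ 1)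
          δ , 0<δ , ball⊆ = Ball-open centre q y (Ball-sym y centre q y∈N)
      in δ , 0<δ , λ z z∈ → Ball-sym centre z q (ball⊆ z z∈)

    N-basis : ∀ x ε → 0ℚ ℚ.< ε → ∃[ s ] x ∈ N X s × (∀ y → y ∈ N X s → y ∈ Ball d x ε)
    N-basis x ε 0<ε =
      let k , 1/1+k<½ε = archimedean (½ ℚ.* ε) (half-pos 0<ε)
          i , near = dense x (1/1+ k) (1/1+-pos k)
          1/1+k+1/1+k<ε = subst (1/1+ k ℚ.+ 1/1+ k ℚ.<_) (half+half ε)
              (ℚₚ.+-mono-< 1/1+k<½ε 1/1+k<½ε)
      in pair i (radiusCode k) , ⇒N i k x near , λ y y∈N →
           <ᵣ-mono (d x y) {1/1+ k ℚ.+ 1/1+ k} {ε} (ℚₚ.<⇒≤ 1/1+k+1/1+k<ε)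
             (Ball-triangle x (r i) y (1/1+ k) (1/1+ k) near
                 (Ball-sym y (r i) (1/1+ k) (N⇒ i k y y∈N)))
      where
      radius-code : ∀ i k → radius (⦅ pair i (radiusCode k) ⦆ 1) ≡ 1/1+ k
      radius-code i k = trans (cong radius (pair₁ i (radiusCode k))) (radius-radiusCode k)

      ⇒N : ∀ i k y → d y (r i) <ᵣ fromℚ (1/1+ k) → y ∈ N X (pair i (radiusCode k))
      ⇒N i k y = subst₂ (λ j q → d y (r j) <ᵣ fromℚ q)
        (sym (pair₀ i (radiusCode k))) (sym (radius-code i k))

      N⇒ : ∀ i k y → y ∈ N X (pair i (radiusCode k)) → d y (r i) <ᵣ fromℚ (1/1+ k)
      N⇒ i k y = subst₂ (λ j q → d y (r j) <ᵣ fromℚ q) (pair₀ i (radiusCode k)) (radius-code i k)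

    ≮ᵣ0 : ∀ x → 0ᵣ ≤ᵣ x → ¬ (x <ᵣ fromℚ 0ℚ)
    ≮ᵣ0 x 0≤x x<0 = let ε , 0<ε , k , close = ≤-<ᵣ-trans 0ᵣ x 0ℚ 0≤x x<0 in
      ℚₚ.<-irrefl refl (ℚₚ.<-trans 0<ε (subst (ℚ._< 0ℚ) (ℚₚ.+-identityˡ ε) (close k ℕₚ.≤-refl)))

    N-emptyCode : ∀ x → x ∉ N X emptyCode
    N-emptyCode x x∈N = ≮ᵣ0 (d x centre) nonNegative
      (subst (λ q → d x centre <ᵣ fromℚ q) radius≡0 x∈N)
      where
      centre : Carrier
      centre = r (⦅ emptyCode ⦆ 0)

      radius≡0 : radius (⦅ emptyCode ⦆ 1) ≡ 0ℚ
      radius≡0 = trans (cong radius (pair₁ 0 (pair 0 0)))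
        (cong₂ (λ a b → + a ℚ./ suc b) (pair₀ 0 0) (pair₁ 0 0))

    Disjoint : ℕ → ℕ → Set c
    Disjoint s t = ∀ x → x ∈ N X s → x ∉ N X t

    disjoint : ℕ → ℕ → Bool
    disjoint s t = does (em {P = Disjoint s t})

    does-true⇒ : ∀ {p} {P : Set p} (P? : Dec P) → does P? ≡ true → P
    does-true⇒ (yes p) _ = p

    disjoint⇒ : ∀ s t → disjoint s t ≡ true → Disjoint s t
    disjoint⇒ s t = does-true⇒ (em {P = Disjoint s t})

    ¬disjoint⇒ : ∀ s t → disjoint s t ≢ true → ∃[ x ] x ∈ N X s × x ∈ N X t
    ¬disjoint⇒ s t ≢true = stable λ ¬∃ →
      ≢true (dec-true (em {P = Disjoint s t}) λ x x∈Ns x∈Nt → ¬∃ (x , x∈Ns , x∈Nt))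

    open OpenCode disjoint

    Boundary : (ℕ → ℕ) → Pred Carrier 0ℓ
    Boundary γ x = x ∉ U X γ × ¬ (∃[ s ] Avoids s γ × x ∈ N X s)

    -- Suppose that a ball lies in the closure of the boundary. It contains a boundary point `y` and
    -- a basic set `s` around `y`. As `y` is not in the exterior, `s` meets some `γ m` at a point
    -- `z`. A neighbourhood of `z` lies inside the open set coded by `γ` and so misses the boundary,
    -- although `z` is in its closure.
    Boundary-nowhereDense : ∀ γ → NowhereDense X (Boundary γ)
    Boundary-nowhereDense γ x (ε , 0<ε , ball⊆) =
      let y , y∈ball , _ , y∉exterior = ball⊆ {x} (centre∈Ball x ε 0<ε) ε 0<ε
          δ , 0<δ , δ-ball⊆ = Ball-open x ε y y∈ball
          s , y∈N , N⊆ball = N-basis y δ 0<δ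
          m , meets = stable λ ¬∃ → y∉exterior (s , (λ m → stable λ ≢true → ¬∃ (m , ≢true)) , y∈N)
          z , z∈Ns , z∈Nm = ¬disjoint⇒ s (γ m) meets
          δ′ , 0<δ′ , δ′-ball⊆ = N-open (γ m) z z∈Nm
          w , w∈ball , w∉U , _ = ball⊆ {z} (δ-ball⊆ z (N⊆ball z z∈Ns)) δ′ 0<δ′
      in w∉U (m , δ′-ball⊆ w w∈ball)

    NowhereDense⇒Meager : {A : Pred Carrier 0ℓ} → NowhereDense X A → Meager X A
    NowhereDense⇒Meager {A} nowhereDense = (λ _ → A) , (λ _ → nowhereDense) , λ x∈A → 0 , x∈A

    Meager-⊆ : {A A′ : Pred Carrier 0ℓ} → (∀ x → x ∈ A → x ∈ A′) → Meager X A′ → Meager X A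
    Meager-⊆ A⊆A′ (F , nowhereDense , A′⊆⋃) = F , nowhereDense , λ {x} x∈A → A′⊆⋃ (A⊆A′ x x∈A)

    Meager-⋃ : (P : ℕ → Pred Carrier 0ℓ) → (∀ n → Meager X (P n)) → Meager X (⋃ ℕ P)
    Meager-⋃ P meager = (λ k → F (⦅ k ⦆ 0) (⦅ k ⦆ 1)) ,
      (λ k → proj₁ (proj₂ (meager (⦅ k ⦆ 0))) (⦅ k ⦆ 1)) ,
      λ {x} (n , x∈P) → let m , x∈F = proj₂ (proj₂ (meager n)) x∈P in
        pair n m , subst₂ (λ i j → x ∈ F i j) (sym (pair₀ n m)) (sym (pair₁ n m)) x∈F
      where
      F : ℕ → ℕ → Pred Carrier 0ℓ
      F n = proj₁ (meager n)

    Meager-∪ : {A A′ : Pred Carrier 0ℓ} → Meager X A → Meager X A′ → Meager X (A ∪ A′)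
    Meager-∪ {A} {A′} meager-A meager-A′ = Meager-⊆
      (λ _ → [ (λ x∈A → 0 , x∈A) , (λ x∈A′ → 1 , x∈A′) ]′)
      (Meager-⋃ choice λ where
        zero    → meager-A
        (suc _) → meager-A′)
      where
      choice : ℕ → Pred Carrier 0ℓ
      choice zero    = A
      choice (suc _) = A′

    ∅-meager : Meager X (λ _ → ⊥)
    ∅-meager = NowhereDense⇒Meager λ x (ε , 0<ε , ball⊆) →
      proj₂ (proj₂ (ball⊆ {x} (centre∈Ball x ε 0<ε) ε 0<ε))

    -- The sets `π α` without reference to ranks

    HasRank : (ℕ → ℕ) → Ord → Set
    HasRank α ξ = ∣ α ∣≡ ξ

    HasRank-resp-≗ : ∀ α α′ ξ → α ≗ α′ → HasRank α ξ → HasRank α′ ξ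
    HasRank-resp-≗ α α′ ξ α≗α′ (b , min) = BC-resp-≗ α≗α′ b ,
      λ η b′ → min η (BC-resp-≗ (λ i → sym (α≗α′ i)) b′)

    HasRank-unique : ∀ α ζ ξ → HasRank α ζ → HasRank α ξ → ζ ≈ₒ ξ
    HasRank-unique α ζ ξ (b , min) (b′ , min′) = min ξ b′ , min′ ζ b

    HasRank-exists : ∀ {ξ α} → BC ξ α → ∃ (HasRank α)
    HasRank-exists {ξ} b = IsLeast-exists (ξ , b)

    -- The recursive call stands under a negation and runs in the opposite direction, so both
    -- accessibility proofs are kept arbitrary.
    πAcc-resp : ∀ ζ ξ a a′ α α′ x → ζ ≈ₒ ξ → α ≗ α′ → πAcc X ζ a α x → πAcc X ξ a′ α′ x
    πAcc-resp ζ ξ (acc rs) (acc rs′) α α′ x ζ≈ξ α≗α′ (inj₁ (ζ≈0 , x∉N)) =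
      inj₁ (≈ₒ-trans {ξ} {ζ} {zeroₒ} (≈ₒ-sym {ζ} {ξ} ζ≈ξ) ζ≈0 ,
            λ x∈N → x∉N (N-resp-≡ X x (sym (α≗α′ 1)) x∈N))
    πAcc-resp ζ ξ (acc rs) (acc rs′) α α′ x ζ≈ξ α≗α′
      (inj₂ (1≤ζ , n , β , ↓β , η , rank , η<ζ , ¬π)) =
      let η<ξ = <-≤ₒ-trans {η} {ζ} {ξ} η<ζ (proj₁ ζ≈ξ) in
      inj₂ (≤ₒ-trans {oneₒ} {ζ} {ξ} 1≤ζ (proj₁ ζ≈ξ) ,
            n , β , Value⇒↓ n α′ β (Value-resp-≗ α≗α′ (↓⇒Value n α β ↓β)) , η , rank , η<ξ ,
            λ π′ → ¬π (πAcc-resp η η (rs′ η<ξ) (rs η<ζ) β β x (≈ₒ-refl {η}) (λ _ → refl) π′))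

    π-resp-≗ : ∀ α α′ x → α ≗ α′ → π X α x → π X α′ x
    π-resp-≗ α α′ x α≗α′ (ζ , rank , x∈π) = ζ , HasRank-resp-≗ α α′ ζ α≗α′ rank ,
      πAcc-resp ζ ζ (<ₒ-wellFounded ζ) (<ₒ-wellFounded ζ) α α′ x (≈ₒ-refl {ζ}) α≗α′ x∈π

    ChildComplement : (ℕ → ℕ) → ℕ → Pred Carrier 0ℓ
    ChildComplement α n x = ∃[ β ] Value n α β × ¬ π X β x

    -- With `π⇐`, this gives the equation of `π α` as the union of the complements of its children,
    -- free of ranks and accessibility proofs.
    π⇒ : ∀ ξ α x → oneₒ ≤ₒ ξ → BC ξ α → π X α x → ∃[ n ] ChildComplement α n x
    π⇒ ξ α x 1≤ξ b (ζ , (b′ , _) , x∈π) = go (<ₒ-wellFounded ζ) x∈π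
      where
      go : ∀ a → πAcc X ζ a α x → ∃[ n ] ChildComplement α n x
      go (acc rs) (inj₁ (ζ≈0 , _)) =
        ⊥-elim (ℕₚ.0≢1+n (trans (sym (BC₀⇒ ζ α ζ≈0 b′)) (proj₁ (BC⇒Step ξ α 1≤ξ b))))
      go (acc rs) (inj₂ (1≤ζ , n , β , ↓β , η , rank , η<ζ , ¬π)) = n , β , ↓⇒Value n α β ↓β ,
        λ (η′ , rank′ , x∈π′) → ¬π (πAcc-resp η′ η (<ₒ-wellFounded η′) (rs η<ζ) β β x
          (HasRank-unique β η′ η rank′ rank) (λ _ → refl) x∈π′)

    π⇐ : ∀ ξ α x n → oneₒ ≤ₒ ξ → BC ξ α → ChildComplement α n x → π X α x
    π⇐ ξ α x n 1≤ξ b (β , v , ¬π) = ρ , rank , go (<ₒ-wellFounded ρ)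
      where
      ρ : Ord
      ρ = proj₁ (HasRank-exists b)

      rank : HasRank α ρ
      rank = proj₂ (HasRank-exists b)

      1≤ρ : oneₒ ≤ₒ ρ
      1≤ρ = [ (λ ρ≈0 → ⊥-elim (ℕₚ.0≢1+n (trans (sym (BC₀⇒ ρ α ρ≈0 (proj₁ rank)))
                                                (proj₁ (BC⇒Step ξ α 1≤ξ b)))))
            , (λ p → p) ]′ (0or1≤ ρ)

      -- The child lies in `BC` of some ordinal below `ρ`, and its rank is minimal.
      childRank : ∃[ η ] HasRank β η × η <ₒ ρ
      childRank =
        let k , β′ , v′ , b′ = proj₂ (BC⇒Step ρ α 1≤ρ (proj₁ rank)) n
            b″ = BC-resp-≗ (Value-unique (λ _ → refl) v′ v) b′
            η , isRank = HasRank-exists b″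
        in η , isRank , ≤-<ₒ-trans {η} {below ρ k} {ρ} (proj₂ isRank (below ρ k) b″)
             (below-< {ρ} 1≤ρ k)

      go : ∀ a → πAcc X ρ a α x
      go (acc rs) = let η , isRank , η<ρ = childRank in
        inj₂ (1≤ρ , n , β , Value⇒↓ n α β v , η , isRank , η<ρ , λ x∈π →
          ¬π (η , isRank , πAcc-resp η η (rs η<ρ) (<ₒ-wellFounded η) β β x
            (≈ₒ-refl {η}) (λ _ → refl) x∈π))

    π-base⇒ : ∀ α x → α 0 ≡ 0 → π X α x → x ∉ N X (α 1)
    π-base⇒ α x α0≡0 (ζ , (b , _) , x∈π) = go (<ₒ-wellFounded ζ) x∈π
      where
      go : ∀ a → πAcc X ζ a α x → x ∉ N X (α 1)
      go (acc rs) (inj₁ (_ , x∉N)) = x∉N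
      go (acc rs) (inj₂ (1≤ζ , _)) =
        ⊥-elim (ℕₚ.0≢1+n (trans (sym α0≡0) (proj₁ (BC⇒Step ζ α 1≤ζ b))))

    π-base⇐ : ∀ α x → α 0 ≡ 0 → x ∉ N X (α 1) → π X α x
    π-base⇐ α x α0≡0 x∉N = zeroₒ , (base (≈ₒ-refl {zeroₒ}) α0≡0 , λ _ _ → tt) ,
      go (<ₒ-wellFounded zeroₒ)
      where
      go : ∀ a → πAcc X zeroₒ a α x
      go (acc rs) = inj₁ (≈ₒ-refl {zeroₒ} , x∉N)

    -- Approximation of Borel sets up to meager sets

    ChildOpen : ∀ ξ α n → Child ξ α n → Pred Carrier 0ℓ
    ChildOpen ξ α n v x = ∃[ s ] x ∈ N X (childEntry ξ α n v s)

    childComplement⇒ : ∀ α n β x → ⟪ α * ⟫ n ↓ β → ChildComplement α n x → ¬ π X β x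
    childComplement⇒ α n β x ↓β (β′ , v , ¬π) x∈π =
      ¬π (π-resp-≗ β β′ x (Value-unique (λ _ → refl) (↓⇒Value n α β ↓β) v) x∈π)

    -- The symmetric difference of two unions is covered by the symmetric differences of their
    -- members, and countable unions of meager sets are meager.
    approximates : ∀ {ξ α} (b : BC ξ α) → oneₒ ≤ₒ ξ → Meager X (π X α △ U X (openCode b))
    child-approximates : ∀ ξ α n (v : Child ξ α n) →
      Meager X (ChildComplement α n △ ChildOpen ξ α n v)

    approximates (base ξ≈0 _) 1≤ξ = ⊥-elim (1≤∧≈0⇒⊥ 1≤ξ ξ≈0)
    approximates {ξ} {α} b@(step _ _ values) 1≤ξ = Meager-⊆ ⊆⋃
      (Meager-⋃ (λ n → ChildComplement α n △ ChildOpen ξ α n (values n))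
                (λ n → child-approximates ξ α n (values n)))
      where
      U⇒ : ∀ x → x ∈ U X (openCode b) → ∃[ n ] ChildOpen ξ α n (values n) x
      U⇒ x (k , x∈N) = ⦅ k ⦆ 0 , ⦅ k ⦆ 1 , x∈N

      U⇐ : ∀ x n → ChildOpen ξ α n (values n) x → x ∈ U X (openCode b)
      U⇐ x n (s , x∈N) = pair n s ,
        subst₂ (λ m t → x ∈ N X (childEntry ξ α m (values m) t))
          (sym (pair₀ n s)) (sym (pair₁ n s)) x∈N

      ⊆⋃ : ∀ x → (π X α △ U X (openCode b)) x →
        ∃[ n ] (ChildComplement α n △ ChildOpen ξ α n (values n)) x
      ⊆⋃ x (inj₁ (x∈π , x∉U)) = let n , x∈ = π⇒ ξ α x 1≤ξ b x∈π in
        n , inj₁ (x∈ , λ x∈O → x∉U (U⇐ x n x∈O))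
      ⊆⋃ x (inj₂ (x∈U , x∉π)) = let n , x∈O = U⇒ x x∈U in
        n , inj₂ (x∈O , λ x∈ → x∉π (π⇐ ξ α x n 1≤ξ b x∈))

    child-approximates ξ α n v@(ζ , _ , β , ↓β , b@(base ζ≈0 β0≡0)) = Meager-⊆ empty ∅-meager
      where
      entry≡ : ∀ s → childEntry ξ α n v s ≡ β 1
      entry≡ s = complementEntry-0 β (openCode b) s β0≡0

      -- A child of rank 0 causes no error: both sets are the basic set `β 1`.
      empty : ∀ x → (ChildComplement α n △ ChildOpen ξ α n v) x → ⊥
      empty x (inj₁ (x∈ , x∉O)) = childComplement⇒ α n β x ↓β x∈
        (π-base⇐ β x β0≡0 λ x∈N → x∉O (0 , N-resp-≡ X x (sym (entry≡ 0)) x∈N))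
      empty x (inj₂ ((s , x∈N) , x∉)) = x∉
        (β , ↓⇒Value n α β ↓β , λ x∈π → π-base⇒ β x β0≡0 x∈π (N-resp-≡ X x (entry≡ s) x∈N))
    child-approximates ξ α n v@(ζ , _ , β , ↓β , b@(step 1≤ζ β0≡1 _)) =
      Meager-⊆ cases (Meager-∪ (approximates b 1≤ζ)
        (NowhereDense⇒Meager (Boundary-nowhereDense (openCode b))))
      where
      γ : ℕ → ℕ
      γ = openCode b

      entry≡ : ∀ s → childEntry ξ α n v s ≡ exteriorEntry s γ
      entry≡ s = complementEntry-1 β γ s β0≡1

      Avoids⇒∈ : ∀ x s → Avoids s γ → x ∈ N X s → ChildOpen ξ α n v x
      Avoids⇒∈ x s avoids x∈N = s ,
        N-resp-≡ X x (sym (trans (entry≡ s) (exteriorEntry-avoids s γ avoids))) x∈N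

      ∈⇒∉U : ∀ x → ChildOpen ξ α n v x → x ∉ U X γ
      ∈⇒∉U x (s , x∈N) (m , x∈Nm) = split (em {P = Avoids s γ})
        where
        split : Dec (Avoids s γ) → ⊥
        split (yes avoids) = disjoint⇒ s (γ m) (avoids m) x
          (N-resp-≡ X x (trans (entry≡ s) (exteriorEntry-avoids s γ avoids)) x∈N) x∈Nm
        split (no ¬avoids) = N-emptyCode x
          (N-resp-≡ X x (trans (entry≡ s) (exteriorEntry-meets s γ ¬avoids)) x∈N)

      -- A point outside `π β` that the exterior misses is either in the open set coded by `γ`, an
      -- error made for `β`, or on the boundary. A point of the exterior that lies in `π β` is again
      -- an error made for `β`.
      cases : ∀ x → (ChildComplement α n △ ChildOpen ξ α n v) x →
        ((π X β △ U X γ) ∪ Boundary γ) x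
      cases x (inj₁ (x∈ , x∉O)) = split (em {P = x ∈ U X γ})
        where
        split : Dec (x ∈ U X γ) → ((π X β △ U X γ) ∪ Boundary γ) x
        split (yes x∈U) = inj₁ (inj₂ (x∈U , childComplement⇒ α n β x ↓β x∈))
        split (no  x∉U) = inj₂ (x∉U , λ (s , avoids , x∈N) → x∉O (Avoids⇒∈ x s avoids x∈N))
      cases x (inj₂ (x∈O , x∉)) = inj₁ (inj₁
        (stable (λ ¬π → x∉ (β , ↓⇒Value n α β ↓β , ¬π)) , ∈⇒∉U x x∈O))

    B-approximates : ∀ ξ α (b : BC ξ α) → oneₒ ≤ₒ ξ → Meager X (B X ξ α △ U X (openCode b))
    B-approximates ξ α b 1≤ξ = Meager-⊆ forget (approximates b 1≤ξ)
      where
      forget : ∀ x → (B X ξ α △ U X (openCode b)) x → (π X α △ U X (openCode b)) x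
      forget x (inj₁ ((_ , x∈π) , x∉U)) = inj₁ (x∈π , x∉U)
      forget x (inj₂ (x∈U , x∉B))       = inj₂ (x∈U , λ x∈π → x∉B (b , x∈π))

theorem8 : (em : ∀ {a} → ExcludedMiddle a) →
    ∀ {p ℓ} (X : PolishSpace p ℓ) → let X₀ = PolishSpace.presentation X in
    Σ[ c ∈ (∀ ξ → oneₒ ≤ₒ ξ → Func (Subspace 𝒩 (BC ξ)) (Presentation.setoid 𝒩)) ]
    (∀ ξ (1≤ξ : oneₒ ≤ₒ ξ) →
    Measurable 𝒩 𝒩 (Σ⁰ 𝒩 (apb em ξ)) (c ξ 1≤ξ) ×
    (∀ α (α∈BC : α ∈ BC ξ) →
    Meager X₀ (B X₀ ξ α △ U X₀ (Func.to (c ξ 1≤ξ) (α , α∈BC))))) ×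
    (∀ η ξ (1≤η : oneₒ ≤ₒ η) (1≤ξ : oneₒ ≤ₒ ξ) → twoₒ ≤ₒ η → η <ₒ ξ →
    ∀ α (α∈BCη : α ∈ BC η) (α∈BCξ : α ∈ BC ξ) →
    Func.to (c ξ 1≤ξ) (α , α∈BCξ) ≗ Func.to (c η 1≤η) (α , α∈BCη)) ×
    (∀ η ξ (1≤η : oneₒ ≤ₒ η) (1≤ξ : oneₒ ≤ₒ ξ) → η ≈ₒ ξ →
    ∀ α (α∈BCη : α ∈ BC η) (α∈BCξ : α ∈ BC ξ) →
    Func.to (c ξ 1≤ξ) (α , α∈BCξ) ≗ Func.to (c η 1≤η) (α , α∈BCη))
theorem8 em X =
  (λ ξ _ → openCodeFunc ξ) ,
  (λ ξ 1≤ξ → openCode-measurable ξ 1≤ξ , λ α b → B-approximates ξ α b 1≤ξ) ,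
  (λ η ξ _ _ _ _ α b b′ → openCode-cong b′ b (λ _ → refl)) ,
  (λ η ξ _ _ _ α b b′ → openCode-cong b′ b (λ _ → refl))
  where
  open Classical em
  open Approximation (PolishSpace.presentation X) (PolishSpace.isPolish X)
  open OpenCode disjoint
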